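{- Let $N\ge 3$, let $v_a,v_b$ with $1\le a<b\le N$ be two distinct rim vertices of the wheel graph $W_{N+1}$ with central vertex $c$, and let $d=b-a$, so that the two cyclic intervals determined by $\{v_a,v_b\}$ are $d$ and $N-d$. Then $$\mathcal F_{W_{N+1}}(\{c,v_a,v_b\})=\tau(W_{N+1}/\{c,v_a,v_b\})=F_{2d}F_{2(N-d)}.$$
   Context: The wheel graph $W_{N+1}$ ($N\ge3$) has vertex set $\{c,v_1,\ldots,v_N\}$ and edges $\{v_i,v_{i+1}\}$ (indices modulo $N$) and $\{c,v_i\}$ for $1\le i\le N$; $c$ is the central vertex and the $v_i$ are the rim vertices. For a finite connected graph $G$ and $\varnothing\ne S\subseteq V(G)$, a rooted spanning forest of $G$ with root set $S$ is a spanning forest (an acyclic subgraph containing all vertices of $G$) in which each connected component contains exactly one vertex of $S$; $\mathcal F_G(S)$ denotes the number of such forests. $G/S$ is the multigraph obtained from $G$ by identifying all vertices of $S$ into a single vertex, keeping multiple edges with their multiplicities and deleting loops. $\tau(H)$ is the number of spanning trees of $H$, where parallel edges are regarded as distinct. Fibonacci numbers: $F_0=0$, $F_1=1$, $F_{n+2}=F_{n+1}+F_n$. -}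

module Defs where

open import Data.Fin as Fin using (Fin; zero; suc; toℕ; punchIn)
import Data.Fin.Properties as Fin
open import Data.Fin.Subset using (Subset; inside; outside; _∈_; ∁; ∣_∣)
open import Data.Fin.Subset.Properties using (_∈?_)
open import Data.List as List using (List; []; _∷_; _++_; map; filter; length; lookup; allFin)
import Data.List.Membership.Propositional as List
import Data.List.Membership.Propositional.Properties as List
open import Data.List.Relation.Unary.Any using (here; there)
open import Data.List.Relation.Unary.Unique.Propositional using (Unique; []; _∷_)
import Data.List.Relation.Unary.All as All
import Data.List.Relation.Unary.Unique.DecPropositional as DecUnique
open import Data.Nat using (ℕ; zero; suc; _+_; _≤_; s≤s)
open import Data.Nat.DivMod using (_mod_)
open import Data.Product as Product using (Σ; ∃; ∃!; _×_; _,_; proj₂)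
open import Data.Product.Properties using (≡-dec)
open import Data.Sum using (_⊎_; inj₁; inj₂)
open import Data.Vec as Vec using ([]; _∷_)
open import Level using (0ℓ)
open import Relation.Binary using (DecidableEquality)
open import Relation.Binary.Construct.Closure.ReflexiveTransitive as Star
  using (Star; ε; _◅_; _◅◅_)
open import Relation.Binary.PropositionalEquality using (_≡_; _≢_; refl; sym; cong)
open import Relation.Nullary using (¬_; Dec; yes; no; ¬?; _×-dec_; _⊎-dec_; _→-dec_; contradiction)
open import Relation.Nullary.Decidable using (map′)
open import Relation.Unary using (Pred; Decidable)

fib : ℕ → ℕ
fib 0             = 0
fib 1             = 1
fib (suc (suc n)) = fib (suc n) + fib n

-- An edge is a position in the list `edges`, so that parallel edges are
-- distinct; the order in which an edge lists its two ends is irrelevant.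
record Multigraph : Set where
  field
    order : ℕ
    edges : List (Fin order × Fin order)

  Vertex : Set
  Vertex = Fin order

  size : ℕ
  size = length edges

  Edge : Set
  Edge = Fin size

  Joins : Edge → Vertex → Vertex → Set
  Joins e u v = lookup edges e ≡ (u , v) ⊎ lookup edges e ≡ (v , u)

  -- A set A of edges stands for the spanning subgraph with edge set A.
  Step : Subset size → Vertex → Vertex → Set
  Step A u v = ∃ λ e → e ∈ A × Joins e u v

  Walk : Subset size → Vertex → Vertex → Set
  Walk A = Star (Step A)

  walkEdges : ∀ {A u v} → Walk A u v → List Edge
  walkEdges ε             = []
  walkEdges ((e , _) ◅ w) = e ∷ walkEdges w

  -- The last vertex is left out.
  walkVertices : ∀ {A u v} → Walk A u v → List Vertex
  walkVertices         ε       = []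
  walkVertices {u = u} (_ ◅ w) = u ∷ walkVertices w

  -- A loop is a cycle of length 1 and two parallel edges form one of length 2.
  IsCycle : ∀ {A u} → Walk A u u → Set
  IsCycle w = walkEdges w ≢ [] × Unique (walkEdges w) × Unique (walkVertices w)

  Acyclic : Subset size → Set
  Acyclic A = ¬ (∃ λ u → Σ (Walk A u u) IsCycle)

  Connected : Subset size → Set
  Connected A = ∀ u v → Walk A u v

  IsSpanningTree : Subset size → Set
  IsSpanningTree A = Connected A × Acyclic A

  IsRootedForest : Subset order → Subset size → Set
  IsRootedForest S A =
    Acyclic A × (∀ u → ∃! _≡_ λ s → s ∈ S × Walk A u s)

module _ (G : Multigraph) where
  open Multigraph G

  private
    _≟ᵉ_ : DecidableEquality (Vertex × Vertex)
    _≟ᵉ_ = ≡-dec Fin._≟_ Fin._≟_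

    joins? : ∀ e u v → Dec (Joins e u v)
    joins? e u v = (lookup edges e ≟ᵉ (u , v)) ⊎-dec (lookup edges e ≟ᵉ (v , u))

    Via : List Edge → Vertex → Vertex → Set
    Via L = Star λ u v → ∃ λ e → e List.∈ L × Joins e u v

    weaken : ∀ {e L u v} → Via L u v → Via (e ∷ L) u v
    weaken = Star.map λ (e , e∈L , j) → e , there e∈L , j

    Split : Edge → List Edge → Vertex → Vertex → Set
    Split e L u v = let (x , y) = lookup edges e in
      Via L u v ⊎ (Via L u x × Via L y v) ⊎ (Via L u y × Via L x v)

    join : ∀ e {L u v} → Split e L u v → Via (e ∷ L) u v
    join e (inj₁ w)              = weaken w
    join e (inj₂ (inj₁ (p , q))) = weaken p ◅◅ (e , here refl , inj₁ refl) ◅ weaken q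
    join e (inj₂ (inj₂ (p , q))) = weaken p ◅◅ (e , here refl , inj₂ refl) ◅ weaken q

    split : ∀ e {L u v} → Via (e ∷ L) u v → Split e L u v
    split e ε = inj₁ ε
    split e ((f , there f∈L , j) ◅ w) with split e w
    ... | inj₁ p              = inj₁ ((f , f∈L , j) ◅ p)
    ... | inj₂ (inj₁ (p , q)) = inj₂ (inj₁ ((f , f∈L , j) ◅ p , q))
    ... | inj₂ (inj₂ (p , q)) = inj₂ (inj₂ ((f , f∈L , j) ◅ p , q))
    split e ((.e , here refl , inj₁ eq) ◅ w) with lookup edges e | eq | split e w
    ... | _ | refl | inj₁ p              = inj₂ (inj₁ (ε , p))
    ... | _ | refl | inj₂ (inj₁ (_ , q)) = inj₂ (inj₁ (ε , q))
    ... | _ | refl | inj₂ (inj₂ (_ , q)) = inj₁ q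
    split e ((.e , here refl , inj₂ eq) ◅ w) with lookup edges e | eq | split e w
    ... | _ | refl | inj₁ p              = inj₂ (inj₂ (ε , p))
    ... | _ | refl | inj₂ (inj₁ (_ , q)) = inj₁ q
    ... | _ | refl | inj₂ (inj₂ (_ , q)) = inj₂ (inj₂ (ε , q))

    via? : ∀ L u v → Dec (Via L u v)
    via? []      u v = map′ (λ { refl → ε }) (λ { ε → refl ; ((_ , () , _) ◅ _) }) (u Fin.≟ v)
    via? (e ∷ L) u v = let (x , y) = lookup edges e in
      map′ (join e) (split e)
        (via? L u v ⊎-dec (via? L u x ×-dec via? L y v) ⊎-dec (via? L u y ×-dec via? L x v))

    WalkOfLength : Subset size → (List Edge → List Vertex → Set) → ℕ → Vertex → Vertex → Set
    WalkOfLength A P k u v =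
      Σ (Walk A u v) λ w → length (walkEdges w) ≡ k × P (walkEdges w) (walkVertices w)

    walkOfLength? : ∀ A (P : List Edge → List Vertex → Set) → (∀ es vs → Dec (P es vs)) →
                    ∀ k u v → Dec (WalkOfLength A P k u v)
    walkOfLength? A P P? zero u v =
      map′ (λ { (refl , p) → ε , refl , p })
           (λ { (ε , _ , p) → refl , p })
           (u Fin.≟ v ×-dec P? [] [])
    walkOfLength? A P P? (suc k) u v =
      map′ (λ { (e , e∈A , x , j , w , refl , p) → (e , e∈A , j) ◅ w , refl , p })
           (λ { (_◅_ {j = x} (e , e∈A , j) w , refl , p) → e , e∈A , x , j , w , refl , p })
           (Fin.any? λ e → e ∈? A ×-dec Fin.any? λ x → joins? e u x ×-dec
              walkOfLength? A (λ es vs → P (e ∷ es) (u ∷ vs)) (λ es vs → P? (e ∷ es) (u ∷ vs)) k x v)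

    lookup-injective : ∀ {n} {xs : List (Fin n)} → Unique xs →
                       ∀ {i j} → lookup xs i ≡ lookup xs j → i ≡ j
    lookup-injective (x∉xs ∷ u) {zero}  {zero}  eq = refl
    lookup-injective (x∉xs ∷ u) {zero}  {suc j} eq = contradiction eq (All.lookup x∉xs (List.∈-lookup j))
    lookup-injective (x∉xs ∷ u) {suc i} {zero}  eq = contradiction (sym eq) (All.lookup x∉xs (List.∈-lookup i))
    lookup-injective (x∉xs ∷ u) {suc i} {suc j} eq = cong suc (lookup-injective u eq)

    unique⇒length≤ : ∀ {n} {xs : List (Fin n)} → Unique xs → length xs ≤ n
    unique⇒length≤ u = Fin.injective⇒≤ (lookup-injective u)

    empty? : (es : List Edge) → Dec (es ≡ [])
    empty? []      = yes refl
    empty? (_ ∷ _) = no λ ()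

  walk? : ∀ A u v → Dec (Walk A u v)
  walk? A u v =
    map′ (Star.map λ (e , e∈L , j) → e , proj₂ (List.∈-filter⁻ (_∈? A) {xs = allFin size} e∈L) , j)
         (Star.map λ (e , e∈A , j) → e , List.∈-filter⁺ (_∈? A) (List.∈-allFin e) e∈A , j)
         (via? (filter (_∈? A) (allFin size)) u v)

  acyclic? : Decidable Acyclic
  acyclic? A = ¬? (map′
    (λ { (u , _ , w , _ , cyc) → u , w , cyc })
    (λ { (u , w , cyc@(_ , uniq , _)) →
           u , Fin.fromℕ< (s≤s (unique⇒length≤ uniq)) , w ,
           sym (Fin.toℕ-fromℕ< (s≤s (unique⇒length≤ uniq))) , cyc })
    (Fin.any? λ u → Fin.any? {suc size} λ k →
       walkOfLength? A (λ es vs → es ≢ [] × Unique es × Unique vs)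
         (λ es vs → ¬? (empty? es) ×-dec uniqueᵉ? es ×-dec uniqueᵛ? vs)
         (toℕ k) u u))
    where
    open DecUnique (Fin._≟_ {size})  using () renaming (unique? to uniqueᵉ?)
    open DecUnique (Fin._≟_ {order}) using () renaming (unique? to uniqueᵛ?)

  isSpanningTree? : Decidable IsSpanningTree
  isSpanningTree? A = (Fin.all? λ u → Fin.all? λ v → walk? A u v) ×-dec acyclic? A

  isRootedForest? : ∀ S → Decidable (IsRootedForest S)
  isRootedForest? S A = acyclic? A ×-dec Fin.all? λ u → unique? u
    where
    R : Vertex → Vertex → Set
    R u s = s ∈ S × Walk A u s

    R? : ∀ u s → Dec (R u s)
    R? u s = s ∈? S ×-dec walk? A u s

    unique? : ∀ u → Dec (∃! _≡_ (R u))
    unique? u =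
      map′ (λ (s , r , f) → s , r , λ {t} → f t)
           (λ (s , r , f) → s , r , λ t → f {t})
           (Fin.any? λ s → R? u s ×-dec Fin.all? λ t → R? u t →-dec s Fin.≟ t)

subsets : ∀ n → List (Subset n)
subsets zero    = [] ∷ []
subsets (suc n) = map (inside ∷_) (subsets n) ++ map (outside ∷_) (subsets n)

count : ∀ {n} {P : Pred (Subset n) 0ℓ} → Decidable P → ℕ
count {n} P? = length (filter P? (subsets n))

𝓕 : (G : Multigraph) → Subset (Multigraph.order G) → ℕ
𝓕 G S = count (isRootedForest? G S)

τ : Multigraph → ℕ
τ G = count (isSpanningTree? G)

-- The vertices of S all go to zero; those outside S go injectively to the
-- nonzero elements, in increasing order.
collapse : ∀ {n} (S : Subset n) → Fin n → Fin (suc ∣ ∁ S ∣)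
collapse (inside  ∷ S) zero    = zero
collapse (outside ∷ S) zero    = suc zero
collapse (inside  ∷ S) (suc v) = collapse S v
collapse (outside ∷ S) (suc v) = punchIn (suc zero) (collapse S v)

-- Every edge keeps its multiplicity, except that the loops are deleted.
-- For empty S there would be an extra, isolated vertex zero.
infixl 7 _/_
_/_ : (G : Multigraph) → Subset (Multigraph.order G) → Multigraph
G / S = record
  { order = suc ∣ ∁ S ∣
  ; edges = filter (λ (u , v) → ¬? (u Fin.≟ v))
                   (map (Product.map (collapse S) (collapse S)) (Multigraph.edges G))
  }

hub : ∀ {N} → Fin (suc N)
hub = zero

-- The rim vertices v₁, …, v_N are rim 0, …, rim (N - 1).
rim : ∀ {N} → Fin N → Fin (suc N)
rim = suc

next : ∀ {N} → Fin N → Fin N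
next {suc n} i = suc (toℕ i) mod suc n

wheel : ℕ → Multigraph
wheel N = record
  { order = suc N
  ; edges = map (λ i → rim i , rim (next i)) (allFin N)
         ++ map (λ i → hub , rim i) (allFin N)
  }

{-# OPTIONS --safe #-}

-- Contracting the edges of a forest one after the other, starting from the partition of the
-- vertices that glues S together, turns both counts into the same deletion–contraction recursion.
-- On the wheel, order the edges as (v_k, v_{k+1}), (c, v_{k+1}) for k = a, a+1, …, a+N-1 and keep
-- only whether the component of the current rim vertex has already reached the glued roots: the
-- number H of completions if it has and the number X if it has not satisfy, at each further
-- ordinary rim vertex, H′ = 2H + X and X′ = H + X, the recursion of F_{2m+2} and F_{2m+1}.
-- At a root both states return to H, so the two arcs contribute independent factors.
module Submission where

open import Defs
open import Data.Fin as Fin using (Fin; zero; suc; toℕ; punchIn)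
import Data.Fin.Properties as Fin
open import Data.Fin.Subset using (Subset; Side; inside; outside; ∁; ∣_∣; Nonempty; _∪_; ⁅_⁆)
  renaming (_∈_ to _∈ˢ_)
open import Data.Fin.Subset.Properties using (_∈?_; x∈⁅x⁆; x∈⁅y⁆⇒x≡y; x∈p∪q⁺; x∈p∪q⁻)
open import Data.List as List
  using (List; []; _∷_; _++_; _∷ʳ_; map; filter; length; lookup; allFin; tabulate)
open import Data.List.Properties
  using (filter-++; length-++; length-map; filter-none; map-id-local; map-tabulate; ++-assoc; map-++)
open import Data.List.Membership.DecPropositional using () renaming (_∈?_ to decMember)
open import Data.List.Membership.Propositional using (_∈_)
open import Data.List.Membership.Propositional.Properties
  using (∈-map⁺; ∈-map⁻; ∈-allFin; ∈-++⁺ˡ; ∈-++⁺ʳ)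
open import Data.List.Relation.Binary.Permutation.Propositional as ↭
  using (_↭_; ↭-sym; ↭-trans; ↭-reflexive; ↭⇒↭ₛ)
open import Data.List.Relation.Binary.Permutation.Propositional.Properties
  using (shift; ∷↭∷ʳ; ∈-resp-↭; ++⁺)
import Data.List.Relation.Binary.Permutation.Setoid.Properties as ↭ₛ
open import Data.List.Relation.Unary.All as All using (All; []; _∷_)
import Data.List.Relation.Unary.All.Properties as All
open import Data.List.Relation.Unary.AllPairs as AllPairs using (AllPairs; []; _∷_)
import Data.List.Relation.Unary.AllPairs.Properties as AllPairs
open import Data.List.Relation.Unary.Any using (here; there)
open import Data.List.Relation.Unary.Unique.Propositional using (Unique)
import Data.List.Relation.Unary.Unique.Propositional.Properties as Unique
open import Data.Nat using (ℕ; zero; suc; _+_; _*_; _∸_; _≤_)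
open import Data.Nat.DivMod using (_mod_; _%_; m%n<n; m<n⇒m%n≡m; [m+n]%n≡m%n)
open import Data.Nat.Properties
  using (+-suc; +-identityʳ; +-assoc; *-suc; *-identityʳ; *-distribʳ-+; m≤n⇒∃[o]m+o≡n; m+n∸m≡n;
         m∸n≤m; ≤-<-trans)
open import Data.Nat.Solver using (module +-*-Solver)
open import Data.Product as Product using (∃; Σ; _×_; _,_; proj₁; proj₂)
open import Data.Sum as Sum using (_⊎_; inj₁; inj₂; [_,_]′)
open import Data.Unit using (⊤; tt)
open import Data.Vec using ([]; _∷_; here; there)
open import Function using (_∘_; id; _⇔_; mk⇔; Equivalence)
open import Level using (0ℓ)
open import Relation.Binary using (Rel; IsEquivalence)
open import Relation.Binary.Construct.Closure.ReflexiveTransitive as Star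
  using (Star; ε; _◅_; _◅◅_)
import Relation.Binary.Construct.On as On
open import Relation.Binary.PropositionalEquality as ≡
  using (_≡_; _≢_; refl; sym; trans; cong; cong₂; subst; module ≡-Reasoning)
open import Relation.Nullary using (¬_; Dec; yes; no; contradiction; ¬?)
open import Relation.Nullary.Decidable using (decidable-stable)
open import Relation.Unary using (Pred; Decidable)

open Equivalence using (to; from)

-- Forests and trees are defined by walks and cycles, while the recursion contracts edges, which
-- would change the vertex type at every step. A labelling of the unchanged vertex set therefore
-- stands in for the contracted graph, and only its kernel matters. The bridge to walks is
-- minimality: the kernel of `components f L A` is the least equivalence containing the kernel of
-- `f` and the chosen edges, so it can be compared with walk connectivity or any other equivalence.
-- Acyclicity becomes the test that each chosen edge joins two different classes when it is
-- inserted. That the order of insertion does not matter links this test to the usual criterion: no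
-- walk through the other edges joins the ends. Two labellings with the same kernel are used.
-- `collapse S` leads to the quotient graph; `retract S` keeps the hub as the label of the glued
-- roots and suits the wheel.

private
  variable
    n m k : ℕ
    V W : Set

-- Partitions of the vertex set

Edges : Set → Set
Edges V = List (V × V)

-- The label set does not shrink: `q` merely falls out of use. The asymmetry decides which label
-- survives.
merge : Fin m → Fin m → Fin m → Fin m
merge p q x with x Fin.≟ q
... | yes _ = p
... | no  _ = x

merge-glues : (p q : Fin m) → merge p q p ≡ merge p q q
merge-glues p q with p Fin.≟ q | q Fin.≟ q
... | yes _ | yes _  = refl
... | no  _ | yes _  = refl
... | _     | no q≢q = contradiction refl q≢q

merge-target : (p q : Fin m) → merge p q q ≡ p
merge-target p q with q Fin.≟ q
... | yes _  = refl
... | no q≢q = contradiction refl q≢q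

merge-fixes : {p q x : Fin m} → x ≢ q → merge p q x ≡ x
merge-fixes {q = q} {x} x≢q with x Fin.≟ q
... | yes x≡q = contradiction x≡q x≢q
... | no _    = refl

merge-kernel : (p q : Fin m) {x y : Fin m} → merge p q x ≡ merge p q y →
               x ≡ y ⊎ (x ≡ p × y ≡ q) ⊎ (x ≡ q × y ≡ p)
merge-kernel p q {x} {y} eq with x Fin.≟ q | y Fin.≟ q
... | yes x≡q | yes y≡q = inj₁ (trans x≡q (sym y≡q))
... | yes x≡q | no  _   = inj₂ (inj₂ (x≡q , sym eq))
... | no  _   | yes y≡q = inj₂ (inj₁ (eq , y≡q))
... | no  _   | no  _   = inj₁ eq

-- A labelling f of the vertices stands for the quotient of the vertex set by its kernel.
Labelling : Set → ℕ → Set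
Labelling V m = V → Fin m

infix 4 _⊑_ _≈_
_⊑_ : Labelling V m → Labelling V k → Set
f ⊑ g = ∀ {x y} → f x ≡ f y → g x ≡ g y

_≈_ : Labelling V m → Labelling V k → Set
f ≈ g = f ⊑ g × g ⊑ f

contract : Labelling V m → V → V → Labelling V m
contract f u v = merge (f u) (f v) ∘ f

-- `R` is an arbitrary equivalence because it will also be instantiated with walk connectivity and
-- `Joined`, which are not given as kernels.
contract-least : (f : Labelling V m) {R : Rel V 0ℓ} → IsEquivalence R →
                 (∀ {x y} → f x ≡ f y → R x y) →
                 ∀ {u v} → R u v → ∀ {x y} → contract f u v x ≡ contract f u v y → R x y
contract-least f R-equiv f⇒R {u} {v} Ruv eq with merge-kernel (f u) (f v) eq
... | inj₁ x≈y                 = f⇒R x≈y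
... | inj₂ (inj₁ (x≈u , y≈v)) = R.trans (f⇒R x≈u) (R.trans Ruv (f⇒R (sym y≈v)))
  where module R = IsEquivalence R-equiv
... | inj₂ (inj₂ (x≈v , y≈u)) = R.trans (f⇒R x≈v) (R.trans (R.sym Ruv) (f⇒R (sym y≈u)))
  where module R = IsEquivalence R-equiv

kernel : (g : Labelling V k) → IsEquivalence (λ x y → g x ≡ g y)
kernel g = On.isEquivalence g ≡.isEquivalence

contract-⊑ : (f : Labelling V m) (g : Labelling V k) {u v : V} →
             f ⊑ g → g u ≡ g v → contract f u v ⊑ g
contract-⊑ f g f⊑g = contract-least f (kernel g) f⊑g

⊑-contract : (f : Labelling V m) (u v : V) → f ⊑ contract f u v
⊑-contract f u v = cong (merge (f u) (f v))

contract-glues : (f : Labelling V m) (u v : V) → contract f u v u ≡ contract f u v v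
contract-glues f u v = merge-glues (f u) (f v)

contract-mono : (f : Labelling V m) (g : Labelling V k) (u v : V) →
                f ⊑ g → contract f u v ⊑ contract g u v
contract-mono f g u v f⊑g =
  contract-⊑ f (contract g u v) (⊑-contract g u v ∘ f⊑g) (contract-glues g u v)

contract-cong : (f : Labelling V m) (g : Labelling V k) (u v : V) →
                f ≈ g → contract f u v ≈ contract g u v
contract-cong f g u v (f⊑g , g⊑f) = contract-mono f g u v f⊑g , contract-mono g f u v g⊑f

contract-swap-⊑ : (f : Labelling V m) (u v p q : V) →
                  contract (contract f u v) p q ⊑ contract (contract f p q) u v
contract-swap-⊑ f u v p q =
  contract-⊑ (contract f u v) h
    (contract-⊑ f h (⊑-contract g u v ∘ ⊑-contract f p q) (contract-glues g u v))
    (⊑-contract g u v (contract-glues f p q))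
  where
  g = contract f p q
  h = contract g u v

contract-swap : (f : Labelling V m) (u v p q : V) →
                contract (contract f u v) p q ≈ contract (contract f p q) u v
contract-swap f u v p q = contract-swap-⊑ f u v p q , contract-swap-⊑ f p q u v

-- If gluing `p` and `q` identified `u` with `v`, the two pairs would name the same two classes of
-- `f`, so gluing `u` and `v` would already identify `p` with `q`.
contract-swap-≢ : (f : Labelling V m) (u v p q : V) →
                  f u ≢ f v → contract f u v p ≢ contract f u v q →
                  contract f p q u ≢ contract f p q v
contract-swap-≢ f u v p q u≢v p≢q eq with merge-kernel (f p) (f q) eq
... | inj₁ u≈v                 = u≢v u≈v
... | inj₂ (inj₁ (u≈p , v≈q)) =
  p≢q (trans (⊑-contract f u v (sym u≈p)) (trans (contract-glues f u v) (⊑-contract f u v v≈q)))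
... | inj₂ (inj₂ (u≈q , v≈p)) =
  p≢q (trans (⊑-contract f u v (sym v≈p)) (trans (sym (contract-glues f u v)) (⊑-contract f u v u≈q)))

-- Acyclicity in the style of Kruskal's algorithm, relative to the classes that `f` has glued
-- beforehand.
Forest : Labelling V m → (L : Edges V) → Subset (length L) → Set
Forest f []            []            = ⊤
Forest f ((u , v) ∷ L) (inside  ∷ A) = f u ≢ f v × Forest (contract f u v) L A
Forest f ((u , v) ∷ L) (outside ∷ A) = Forest f L A

components : Labelling V m → (L : Edges V) → Subset (length L) → Labelling V m
components f []            []            = f
components f ((u , v) ∷ L) (inside  ∷ A) = components (contract f u v) L A
components f ((u , v) ∷ L) (outside ∷ A) = components f L A

Tree : Labelling V m → (L : Edges V) → Subset (length L) → Set
Tree f L A = Forest f L A × (∀ x y → components f L A x ≡ components f L A y)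

forest-cong : (f : Labelling V m) (g : Labelling V k) → f ≈ g →
              ∀ (L : Edges V) A → Forest f L A → Forest g L A
forest-cong f g f≈g []            []            _            = tt
forest-cong f g f≈g ((u , v) ∷ L) (inside  ∷ A) (u≢v , F) =
  u≢v ∘ proj₂ f≈g , forest-cong _ _ (contract-cong f g u v f≈g) L A F
forest-cong f g f≈g (_ ∷ L)       (outside ∷ A) F = forest-cong f g f≈g L A F

⊑-components : (f : Labelling V m) → ∀ (L : Edges V) A → f ⊑ components f L A
⊑-components f []            []            = id
⊑-components f ((u , v) ∷ L) (inside  ∷ A) = ⊑-components (contract f u v) L A ∘ ⊑-contract f u v
⊑-components f (_ ∷ L)       (outside ∷ A) = ⊑-components f L A

components-glue : (f : Labelling V m) → ∀ (L : Edges V) A {e} → e ∈ˢ A →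
                  let (u , v) = lookup L e in components f L A u ≡ components f L A v
components-glue f ((u , v) ∷ L) (inside ∷ A) here =
  ⊑-components (contract f u v) L A (contract-glues f u v)
components-glue f ((u , v) ∷ L) (inside  ∷ A) (there e∈A) = components-glue (contract f u v) L A e∈A
components-glue f (_ ∷ L)       (outside ∷ A) (there e∈A) = components-glue f L A e∈A

components-least : (f : Labelling V m) {R : Rel V 0ℓ} → IsEquivalence R →
                   (∀ {x y} → f x ≡ f y → R x y) → ∀ (L : Edges V) A →
                   (∀ {e} → e ∈ˢ A → let (u , v) = lookup L e in R u v) →
                   ∀ {x y} → components f L A x ≡ components f L A y → R x y
components-least f R-equiv f⇒R []            []            _   = f⇒R
components-least f R-equiv f⇒R ((u , v) ∷ L) (inside  ∷ A) A⇒R =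
  components-least (contract f u v) R-equiv (contract-least f R-equiv f⇒R (A⇒R here)) L A (A⇒R ∘ there)
components-least f R-equiv f⇒R (_ ∷ L)       (outside ∷ A) A⇒R =
  components-least f R-equiv f⇒R L A (A⇒R ∘ there)

-- Both kernels are the least equivalence containing the kernel of `f`, the edges of `A` and the
-- pair `u`, `v`; minimality of each gives one inclusion.
components-contract : (f : Labelling V m) (u v : V) → ∀ (L : Edges V) A →
                      components (contract f u v) L A ≈ contract (components f L A) u v
components-contract f u v L A =
  components-least (contract f u v) (kernel c)
    (contract-⊑ f c (⊑-contract r u v ∘ ⊑-components f L A) (contract-glues r u v))
    L A (⊑-contract r u v ∘ components-glue f L A) ,
  contract-⊑ r (components f′ L A)
    (components-least f (kernel _) (⊑-components f′ L A ∘ ⊑-contract f u v) L A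
      (components-glue f′ L A))
    (⊑-components f′ L A (contract-glues f u v))
  where
  f′ = contract f u v
  r = components f L A
  c = contract r u v

-- The edge from `u` to `v` is inserted first on the left and last on the right. The induction moves
-- it past the chosen edges one at a time by `contract-swap`.
forest-contract : (f : Labelling V m) (u v : V) → ∀ (L : Edges V) A →
                  (f u ≢ f v × Forest (contract f u v) L A) ⇔
                  (Forest f L A × components f L A u ≢ components f L A v)
forest-contract f u v [] [] = mk⇔ Product.swap Product.swap
forest-contract f u v (_ ∷ L) (outside ∷ A) = forest-contract f u v L A
forest-contract f u v ((p , q) ∷ L) (inside ∷ A) = mk⇔
  (λ (u≢v , p≢q , F) → let (F′ , ¬c) = to rest (contract-swap-≢ f u v p q u≢v p≢q ,
                                         forest-cong _ _ (contract-swap f u v p q) L A F) in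
    (p≢q ∘ ⊑-contract f u v , F′) , ¬c)
  (λ ((p≢q , F) , ¬c) → let (u≢v , F′) = from rest (F , ¬c) in
    u≢v ∘ ⊑-contract f p q , contract-swap-≢ f p q u v p≢q u≢v ,
    forest-cong _ _ (contract-swap f p q u v) L A F′)
  where
  rest = forest-contract (contract f p q) u v L A

-- Walks and cycles

graph : Edges (Fin n) → Multigraph
graph {n} L = record { order = n ; edges = L }

module _ {n : ℕ} where
  private
    open module Graph (L : Edges (Fin n)) = Multigraph (graph L)
      using (Step; Walk; walkEdges; walkVertices; IsCycle; Acyclic; IsSpanningTree; IsRootedForest)

  private
    variable
      u v x y : Fin n

  step-sym : ∀ L {A : Subset (length L)} → Step L A u v → Step L A v u
  step-sym L (i , i∈A , j) = i , i∈A , Sum.swap j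

  walk-isEquivalence : (L : Edges (Fin n)) (A : Subset (length L)) → IsEquivalence (Walk L A)
  walk-isEquivalence L A = record
    { refl = ε ; sym = Star.reverse (step-sym L) ; trans = _◅◅_ }

  -- From right to left this is minimality, applied to the equivalence of being connected by a walk.
  walk⇔components : ∀ L A → Walk L A u v ⇔ (components id L A u ≡ components id L A v)
  walk⇔components L A = mk⇔ walk⇒
    (components-least id (walk-isEquivalence L A) (λ { refl → ε }) L A
      (λ {i} i∈A → (i , i∈A , inj₁ refl) ◅ ε))
    where
    walk⇒ : Walk L A u v → components id L A u ≡ components id L A v
    walk⇒ ε = refl
    walk⇒ ((i , i∈A , inj₁ eq) ◅ w) with lookup L i | components-glue id L A i∈A
    walk⇒ ((i , i∈A , inj₁ refl) ◅ w) | _ | u≈v = trans u≈v (walk⇒ w)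
    walk⇒ ((i , i∈A , inj₂ eq) ◅ w) with lookup L i | components-glue id L A i∈A
    walk⇒ ((i , i∈A , inj₂ refl) ◅ w) | _ | u≈v = trans (sym u≈v) (walk⇒ w)

  module _ (L : Edges (Fin n)) {e : Fin n × Fin n} {b : Side} {A : Subset (length L)} where
    lift-walk : Walk L A u v → Walk (e ∷ L) (b ∷ A) u v
    lift-walk = Star.map λ (i , i∈A , j) → suc i , there i∈A , j

    lift-edges : (w : Walk L A u v) → walkEdges (e ∷ L) (lift-walk w) ≡ map suc (walkEdges L w)
    lift-edges ε       = refl
    lift-edges (_ ◅ w) = cong (_ ∷_) (lift-edges w)

    lift-vertices : (w : Walk L A u v) → walkVertices (e ∷ L) (lift-walk w) ≡ walkVertices L w
    lift-vertices ε       = refl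
    lift-vertices (_ ◅ w) = cong (_ ∷_) (lift-vertices w)

    lift-unique : (w : Walk L A u v) → Unique (walkEdges L w) → Unique (walkEdges (e ∷ L) (lift-walk w))
    lift-unique w uniq rewrite lift-edges w = Unique.map⁺ Fin.suc-injective uniq

    zero∉lift : (w : Walk L A u v) → All (zero ≢_) (walkEdges (e ∷ L) (lift-walk w))
    zero∉lift ε       = []
    zero∉lift (_ ◅ w) = (λ ()) ∷ zero∉lift w

    lower-walk : (w : Walk (e ∷ L) (b ∷ A) u v) → All (zero ≢_) (walkEdges (e ∷ L) w) →
                 Σ (Walk L A u v) λ w′ → lift-walk w′ ≡ w
    lower-walk ε _ = ε , refl
    lower-walk ((zero  , _       , _) ◅ _) (0≢0 ∷ _) = contradiction refl 0≢0
    lower-walk ((suc i , there q , j) ◅ w) (_ ∷ 0∉w) with lower-walk w 0∉w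
    ... | w′ , refl = (i , q , j) ◅ w′ , refl

    lift-cycle⁻ : (w : Walk L A u u) → IsCycle (e ∷ L) (lift-walk w) → IsCycle L w
    lift-cycle⁻ w (¬empty , uniqᵉ , uniqᵛ)
      rewrite lift-edges w | lift-vertices w =
      (λ eq → ¬empty (cong (map suc) eq)) , Unique.map⁻ uniqᵉ , uniqᵛ

    lift-cycle : (w : Walk L A u u) → IsCycle L w → IsCycle (e ∷ L) (lift-walk w)
    lift-cycle w (¬empty , uniqᵉ , uniqᵛ) rewrite lift-edges w | lift-vertices w =
      nonempty (walkEdges L w) ¬empty , Unique.map⁺ Fin.suc-injective uniqᵉ , uniqᵛ
      where
      nonempty : (es : List (Fin (length L))) → es ≢ [] → map Fin.suc es ≢ []
      nonempty []      ¬e _ = ¬e refl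

  module _ (L : Edges (Fin n)) {A : Subset (length L)} where

    -- The end vertex goes to the front: prefixing the walk with a step from `v` back to `u` gives a
    -- closed walk whose `walkVertices` are exactly this list.
    allVertices : Walk L A u v → List (Fin n)
    allVertices {v = v} w = v ∷ walkVertices L w

    Simple : Walk L A u v → Set
    Simple w = Unique (walkEdges L w) × Unique (allVertices w)

    start∈ : (w : Walk L A u v) → u ∈ allVertices w
    start∈ ε       = here refl
    start∈ (_ ◅ _) = there (here refl)

    weaken∈ : (s : Step L A u x) (w : Walk L A x v) →
              y ∈ allVertices w → y ∈ allVertices (s ◅ w)
    weaken∈ _ w (here y≡v)  = here y≡v
    weaken∈ _ w (there y∈w) = there (there y∈w)

    ends∈ : (w : Walk L A u v) → ∀ {i} → i ∈ walkEdges L w → lookup L i ≡ (x , y) →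
            x ∈ allVertices w × y ∈ allVertices w
    ends∈ (s@(i , _ , inj₁ eq) ◅ w) (here refl) eq′ with trans (sym eq′) eq
    ... | refl = there (here refl) , weaken∈ s w (start∈ w)
    ends∈ (s@(i , _ , inj₂ eq) ◅ w) (here refl) eq′ with trans (sym eq′) eq
    ... | refl = weaken∈ s w (start∈ w) , there (here refl)
    ends∈ (s ◅ w) (there i∈w) eq = Product.map (weaken∈ s w) (weaken∈ s w) (ends∈ w i∈w eq)

    suffix : (w : Walk L A u v) → Simple w → x ∈ allVertices w → Σ (Walk L A x v) Simple
    suffix w s (here refl) = ε , [] , [] ∷ []
    suffix w@(_ ◅ _) s (there (here refl)) = w , s
    suffix (_ ◅ w) (_ ∷ uᵉ , (_ ∷ v∉) ∷ _ ∷ uᵛ) (there (there x∈w)) =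
      suffix w (uᵉ , v∉ ∷ uᵛ) (there x∈w)

    -- The new edge cannot repeat: an edge on `w` has both its ends on `w`, and `u` is not there.
    cons-simple : (s : Step L A u x) (w : Walk L A x v) → Simple w →
                  ¬ u ∈ allVertices w → Simple (s ◅ w)
    cons-simple (i , _ , j) w (uᵉ , v∉ ∷ uᵛ) u∉w =
      All.¬Any⇒All¬ _ i∉w ∷ uᵉ ,
      (u∉w ∘ here ∘ sym ∷ v∉) ∷ All.¬Any⇒All¬ _ (u∉w ∘ there) ∷ uᵛ
      where
      i∉w : ¬ i ∈ walkEdges L w
      i∉w i∈w = [ (λ eq → u∉w (proj₁ (ends∈ w i∈w eq))) , (λ eq → u∉w (proj₂ (ends∈ w i∈w eq))) ]′ j

    simplify : Walk L A u v → Σ (Walk L A u v) Simple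
    simplify ε = ε , [] , [] ∷ []
    simplify {u = u} (s ◅ w) with simplify w
    ... | w′ , simple with decMember Fin._≟_ u (allVertices w′)
    ... | yes u∈w′ = suffix w′ simple u∈w′
    ... | no  u∉w′ = s ◅ w′ , cons-simple s w′ simple u∉w′

  module _ (L : Edges (Fin n)) {A : Subset (length L)} where

    acyclic-tail : ∀ {e b} → Acyclic (e ∷ L) (b ∷ A) → Acyclic L A
    acyclic-tail acyclic (u , w , cycle) = acyclic (u , lift-walk L w , lift-cycle L w cycle)

    acyclic-outside : ∀ {e} → Acyclic L A → Acyclic (e ∷ L) (outside ∷ A)
    acyclic-outside {e} acyclic (u , w , cycle) with lower-walk L w (zero∉ w)
      where
      zero∉ : (w : Walk (e ∷ L) (outside ∷ A) x y) → All (zero ≢_) (walkEdges (e ∷ L) w)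
      zero∉ ε = []
      zero∉ ((suc _ , _) ◅ w) = (λ ()) ∷ zero∉ w
    ... | w′ , refl = acyclic (u , w′ , lift-cycle⁻ L w′ cycle)

    -- A walk can be made simple, and the new edge then closes it to a cycle.
    acyclic⇒¬walk : Acyclic ((u , v) ∷ L) (inside ∷ A) → ¬ Walk L A u v
    acyclic⇒¬walk {u} {v} acyclic w with simplify L w
    ... | w′ , uᵉ , uᵛ = acyclic (v , (zero , here , inj₂ refl) ◅ lift-walk L w′ ,
      (λ ()) , zero∉lift L w′ ∷ lift-unique L w′ uᵉ , subst (Unique ∘ (v ∷_)) (sym (lift-vertices L w′)) uᵛ)

    -- The first edge of the list is used at most once, so a walk that uses it falls there into two
    -- walks that avoid it.
    unique⇒lower-or-cross : (w : Walk ((u , v) ∷ L) (inside ∷ A) x y) → Unique (walkEdges ((u , v) ∷ L) w) →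
      (Σ (Walk L A x y) λ w′ → lift-walk L w′ ≡ w) ⊎
      (Walk L A x u × Walk L A v y) ⊎ (Walk L A x v × Walk L A u y)
    unique⇒lower-or-cross ε _ = inj₁ (ε , refl)
    unique⇒lower-or-cross ((zero , _ , inj₁ refl) ◅ w) (0∉w ∷ _) =
      inj₂ (inj₁ (ε , proj₁ (lower-walk L w 0∉w)))
    unique⇒lower-or-cross ((zero , _ , inj₂ refl) ◅ w) (0∉w ∷ _) =
      inj₂ (inj₂ (ε , proj₁ (lower-walk L w 0∉w)))
    unique⇒lower-or-cross ((suc i , there q , j) ◅ w) (_ ∷ uniq) with unique⇒lower-or-cross w uniq
    ... | inj₁ (w′ , refl)        = inj₁ ((i , q , j) ◅ w′ , refl)
    ... | inj₂ (inj₁ (w₁ , w₂)) = inj₂ (inj₁ ((i , q , j) ◅ w₁ , w₂))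
    ... | inj₂ (inj₂ (w₁ , w₂)) = inj₂ (inj₂ ((i , q , j) ◅ w₁ , w₂))

    acyclic-inside : Acyclic L A → ¬ Walk L A u v → Acyclic ((u , v) ∷ L) (inside ∷ A)
    acyclic-inside acyclic ¬w (x , w , cycle@(_ , uniq , _)) with unique⇒lower-or-cross w uniq
    ... | inj₁ (w′ , refl)        = acyclic (x , w′ , lift-cycle⁻ L w′ cycle)
    -- A cycle through the new edge goes round the other way from one end of that edge to the other,
    -- avoiding it.
    ... | inj₂ (inj₁ (w₁ , w₂)) = ¬w (Star.reverse (step-sym L) (w₂ ◅◅ w₁))
    ... | inj₂ (inj₂ (w₁ , w₂)) = ¬w (w₂ ◅◅ w₁)

  -- `Forest` inserts the head edge first, but the argument with cycles treats it as added last;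
  -- `forest-contract` reconciles the two orders.
  acyclic⇔forest : (L : Edges (Fin n)) (A : Subset (length L)) → Acyclic L A ⇔ Forest id L A
  acyclic⇔forest []            []            = mk⇔ (λ _ → tt) λ
    { _ (_ , ε , ¬empty , _) → ¬empty refl
    ; _ (_ , (() , _) ◅ _ , _) }
  acyclic⇔forest (_ ∷ L)       (outside ∷ A) = mk⇔
    (to (acyclic⇔forest L A) ∘ acyclic-tail L)
    (acyclic-outside L ∘ from (acyclic⇔forest L A))
  acyclic⇔forest ((u , v) ∷ L) (inside  ∷ A) = mk⇔
    (λ acyclic → from (forest-contract id u v L A)
       (to (acyclic⇔forest L A) (acyclic-tail L acyclic) ,
        acyclic⇒¬walk L acyclic ∘ from (walk⇔components L A)))
    (λ forest → let (F , ¬c) = to (forest-contract id u v L A) forest in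
       acyclic-inside L (from (acyclic⇔forest L A) F) (¬c ∘ to (walk⇔components L A)))

  isSpanningTree⇔tree : (L : Edges (Fin n)) (A : Subset (length L)) → IsSpanningTree L A ⇔ Tree id L A
  isSpanningTree⇔tree L A = mk⇔
    (λ (conn , acyclic) → to (acyclic⇔forest L A) acyclic , λ u v → to (walk⇔components L A) (conn u v))
    (λ (forest , conn) → (λ u v → from (walk⇔components L A) (conn u v)) , from (acyclic⇔forest L A) forest)

-- Rooted forests

-- Fixes the kernel but not the labels, so that results hold for `collapse S` and `retract S` alike.
record Collapses (S : Subset n) (c : Labelling (Fin n) m) : Set where
  field
    collapses : ∀ {x y} → x ∈ˢ S → y ∈ˢ S → c x ≡ c y
    separates : ∀ {x y} → c x ≡ c y → x ≡ y ⊎ (x ∈ˢ S × y ∈ˢ S)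

collapse-∈ : {S : Subset n} {x : Fin n} → x ∈ˢ S → collapse S x ≡ zero
collapse-∈ {S = inside  ∷ S} here        = refl
collapse-∈ {S = inside  ∷ S} (there x∈S) = collapse-∈ x∈S
collapse-∈ {S = outside ∷ S} (there x∈S) = cong (punchIn (suc zero)) (collapse-∈ x∈S)

collapse-zero : (S : Subset n) {x : Fin n} → collapse S x ≡ zero → x ∈ˢ S
collapse-zero (inside  ∷ S) {zero}  _  = here
collapse-zero (inside  ∷ S) {suc x} eq = there (collapse-zero S eq)
collapse-zero (outside ∷ S) {suc x} eq =
  there (collapse-zero S (Fin.punchIn-injective (suc zero) _ zero eq))

collapse-separates : (S : Subset n) {x y : Fin n} → collapse S x ≡ collapse S y →
                     x ≡ y ⊎ (x ∈ˢ S × y ∈ˢ S)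
collapse-separates (_       ∷ S) {zero}  {zero}  _  = inj₁ refl
collapse-separates (inside  ∷ S) {zero}  {suc y} eq = inj₂ (here , there (collapse-zero S (sym eq)))
collapse-separates (inside  ∷ S) {suc x} {zero}  eq = inj₂ (there (collapse-zero S eq) , here)
collapse-separates (inside  ∷ S) {suc x} {suc y} eq =
  Sum.map (cong suc) (Product.map there there) (collapse-separates S eq)
collapse-separates (outside ∷ S) {zero}  {suc y} eq = contradiction (sym eq) (Fin.punchInᵢ≢i _ _)
collapse-separates (outside ∷ S) {suc x} {zero}  eq = contradiction eq (Fin.punchInᵢ≢i _ _)
collapse-separates (outside ∷ S) {suc x} {suc y} eq =
  Sum.map (cong suc) (Product.map there there)
    (collapse-separates S (Fin.punchIn-injective (suc zero) _ _ eq))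

collapse-collapses : (S : Subset n) → Collapses S (collapse S)
collapse-collapses S = record
  { collapses = λ x∈S y∈S → trans (collapse-∈ x∈S) (sym (collapse-∈ y∈S))
  ; separates = collapse-separates S }

collapse-suc : (S : Subset n) (k : Fin ∣ ∁ S ∣) → ∃ λ x → collapse S x ≡ suc k
collapse-suc (inside  ∷ S) k = Product.map suc id (collapse-suc S k)
collapse-suc (outside ∷ S) zero = zero , refl
collapse-suc (outside ∷ S) (suc k) =
  Product.map suc (cong (punchIn (suc zero))) (collapse-suc S k)

collapse-surjective : {S : Subset n} → Nonempty S → ∀ k → ∃ λ x → collapse S x ≡ k
collapse-surjective (s , s∈S) zero    = s , collapse-∈ s∈S
collapse-surjective {S = S} _ (suc k) = collapse-suc S k

module _ {S : Subset n} {c : Labelling (Fin n) m} (collapsing : Collapses S c) where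
  open Collapses collapsing

  module _ (L : Edges (Fin n)) (A : Subset (length L)) where
    -- An explicit form of the kernel of `components c L A`. A single passage through `S` is enough,
    -- because all of `S` is one class.
    Joined : Fin n → Fin n → Set
    Joined x y = r x ≡ r y ⊎ ((∃ λ s → s ∈ˢ S × r x ≡ r s) × (∃ λ t → t ∈ˢ S × r y ≡ r t))
      where r = components id L A

    joined-isEquivalence : IsEquivalence Joined
    joined-isEquivalence = record
      { refl = inj₁ refl
      ; sym = Sum.map sym Product.swap
      ; trans = λ
        { (inj₁ p)       (inj₁ q)                   → inj₁ (trans p q)
        ; (inj₁ p)       (inj₂ ((s , s∈S , q) , t)) → inj₂ ((s , s∈S , trans p q) , t)
        ; (inj₂ (s , t , t∈S , p)) (inj₁ q)         → inj₂ (s , t , t∈S , trans (sym q) p)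
        ; (inj₂ (s , _)) (inj₂ (_ , t))             → inj₂ (s , t) } }

    refines : components id L A ⊑ components c L A
    refines = components-least id (kernel (components c L A)) (cong (components c L A)) L A
      (components-glue c L A)

    components-collapse : ∀ {x y} → components c L A x ≡ components c L A y ⇔ Joined x y
    components-collapse = mk⇔
      (components-least c joined-isEquivalence
        (λ eq → [ inj₁ ∘ cong (components id L A) ,
                  (λ (x∈S , y∈S) → inj₂ ((_ , x∈S , refl) , (_ , y∈S , refl))) ]′ (separates eq))
        L A (inj₁ ∘ components-glue id L A))
      λ { (inj₁ p) → refines p
        ; (inj₂ ((s , s∈S , p) , (t , t∈S , q))) →
            trans (refines p) (trans (⊑-components c L A (collapses s∈S t∈S)) (sym (refines q))) }

    Separated : Set
    Separated = ∀ s t → s ∈ˢ S → t ∈ˢ S → components id L A s ≡ components id L A t → s ≡ t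

  -- This needs c to have a single nontrivial class: if c glues 1 with 3 and 2 with 4, the edges 12
  -- and 34 close a cycle although neither pair is connected by them.
  forest-collapse : ∀ L A → Forest c L A ⇔ (Forest id L A × Separated L A)
  forest-collapse [] [] = mk⇔ (λ _ → tt , λ _ _ _ _ eq → eq) (λ _ → tt)
  forest-collapse (_ ∷ L) (outside ∷ A) = forest-collapse L A
  forest-collapse ((u , v) ∷ L) (inside ∷ A) = mk⇔
    (λ F → let (F′ , ¬c) = to (forest-contract c u v L A) F
               (F″ , sep) = to (forest-collapse L A) F′ in
      from (forest-contract id u v L A) (F″ , ¬c ∘ refines L A) , sep⁺ ¬c sep)
    (λ (F , sep) → let (F′ , ¬r) = to (forest-contract id u v L A) F in
      from (forest-contract c u v L A)
        (from (forest-collapse L A) (F′ , λ _ _ s∈S t∈S eq → sep _ _ s∈S t∈S (⊑⁺ eq)) ,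
         λ eq → not-joined sep ¬r (to (components-collapse L A) eq)))
    where
    r = components id L A
    r⁺ = components (contract id u v) L A

    ⊑⁺ : r ⊑ r⁺
    ⊑⁺ = proj₂ (components-contract id u v L A) ∘ ⊑-contract r u v

    glue⁺ : r⁺ u ≡ r⁺ v
    glue⁺ = proj₂ (components-contract id u v L A) (contract-glues r u v)

    sep⁺ : components c L A u ≢ components c L A v → Separated L A →
           Separated ((u , v) ∷ L) (inside ∷ A)
    sep⁺ ¬c sep _ _ s∈S t∈S eq with merge-kernel (r u) (r v) (proj₁ (components-contract id u v L A) eq)
    ... | inj₁ p = sep _ _ s∈S t∈S p
    ... | inj₂ (inj₁ (p , q)) = contradiction
      (from (components-collapse L A) (inj₂ ((_ , s∈S , sym p) , (_ , t∈S , sym q)))) ¬c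
    ... | inj₂ (inj₂ (p , q)) = contradiction
      (from (components-collapse L A) (inj₂ ((_ , t∈S , sym q) , (_ , s∈S , sym p)))) ¬c

    not-joined : Separated ((u , v) ∷ L) (inside ∷ A) → r u ≢ r v → ¬ Joined L A u v
    not-joined sep ¬r (inj₁ p) = ¬r p
    -- The new edge puts the roots `s` and `t` into one component, so they coincide; but then `u`
    -- and `v` were connected before.
    not-joined sep ¬r (inj₂ ((s , s∈S , p) , (t , t∈S , q)))
      with sep _ _ s∈S t∈S (trans (sym (⊑⁺ p)) (trans glue⁺ (⊑⁺ q)))
    ... | refl = ¬r (trans p (sym q))

  -- Existence of a root in each component is connectedness after gluing; uniqueness of the root,
  -- together with acyclicity, is acyclicity after gluing.
  isRootedForest⇔tree : Nonempty S → (L : Edges (Fin n)) (A : Subset (length L)) →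
                        Multigraph.IsRootedForest (graph L) S A ⇔ Tree c L A
  isRootedForest⇔tree (s₀ , s₀∈S) L A = mk⇔
    (λ (acyclic , root) →
      from (forest-collapse L A) (to (acyclic⇔forest L A) acyclic ,
        λ s t s∈S t∈S eq → let (_ , _ , unique) = root s in
          trans (sym (unique (s∈S , from (walk⇔components L A) refl)))
                (unique (t∈S , from (walk⇔components L A) eq))) ,
      λ x y → from (components-collapse L A) (inj₂ (attached (root x) , attached (root y))))
    (λ (forest , connected) → let (forest′ , sep) = to (forest-collapse L A) forest in
      from (acyclic⇔forest L A) forest′ ,
      λ x → let (s , s∈S , eq) = root (to (components-collapse L A) (connected x s₀)) in
        s , (s∈S , from (walk⇔components L A) eq) ,
        λ (t∈S , w) → sep _ _ s∈S t∈S (trans (sym eq) (to (walk⇔components L A) w)))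
    where
    r = components id L A

    attached : ∀ {x} → Product.∃! _≡_ (λ s → s ∈ˢ S × Multigraph.Walk (graph L) A x s) →
               ∃ λ s → s ∈ˢ S × r x ≡ r s
    attached (s , (s∈S , w) , _) = s , s∈S , to (walk⇔components L A) w

    root : ∀ {x} → Joined L A x s₀ → ∃ λ s → s ∈ˢ S × r x ≡ r s
    root (inj₁ eq)      = s₀ , s₀∈S , eq
    root (inj₂ (s , _)) = s

-- Deletion and contraction

indicator : {P : Set} → Dec P → ℕ
indicator (yes _) = 1
indicator (no _)  = 0

unless : {P : Set} → Dec P → ℕ → ℕ
unless (yes _) _ = 0
unless (no _)  k = k

Constant : Labelling V m → List V → Set
Constant f vs = ∀ {x y} → x ∈ vs → y ∈ vs → f x ≡ f y

constant? : (f : Labelling V m) (vs : List V) → Dec (Constant f vs)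
constant? f vs with All.all? (λ x → All.all? (λ y → f x Fin.≟ f y) vs) vs
... | yes p = yes λ x∈ y∈ → All.lookup (All.lookup p x∈) y∈
... | no ¬p = no λ c → ¬p (All.tabulate λ x∈ → All.tabulate λ y∈ → c x∈ y∈)

treeCount : Labelling V m → List V → Edges V → ℕ
treeCount f vs []            = indicator (constant? f vs)
treeCount f vs ((u , v) ∷ L) =
  unless (f u Fin.≟ f v) (treeCount (contract f u v) vs L) + treeCount f vs L

unless-yes : {P : Set} (P? : Dec P) → P → ∀ k → unless P? k ≡ 0
unless-yes (yes _) _ _ = refl
unless-yes (no ¬p) p _ = contradiction p ¬p

unless-no : {P : Set} (P? : Dec P) → ¬ P → ∀ k → unless P? k ≡ k
unless-no (yes p) ¬p _ = contradiction p ¬p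
unless-no (no _)  _  _ = refl

unless-cong : {P Q : Set} (P? : Dec P) (Q? : Dec Q) → (P → Q) → (Q → P) →
              ∀ {i j} → i ≡ j → unless P? i ≡ unless Q? j
unless-cong (yes _) (yes _) _   _   _ = refl
unless-cong (no _)  (no _)  _   _   e = e
unless-cong (yes p) (no ¬q) P⇒Q _   _ = contradiction (P⇒Q p) ¬q
unless-cong (no ¬p) (yes q) _   Q⇒P _ = contradiction (Q⇒P q) ¬p

indicator-cong : {P Q : Set} (P? : Dec P) (Q? : Dec Q) → (P → Q) → (Q → P) →
                 indicator P? ≡ indicator Q?
indicator-cong (yes _) (yes _) _   _   = refl
indicator-cong (no _)  (no _)  _   _   = refl
indicator-cong (yes p) (no ¬q) P⇒Q _   = contradiction (P⇒Q p) ¬q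
indicator-cong (no ¬p) (yes q) _   Q⇒P = contradiction (Q⇒P q) ¬p

treeCount-cong : (f : Labelling V m) (g : Labelling V k) → f ≈ g →
                 ∀ vs L → treeCount f vs L ≡ treeCount g vs L
treeCount-cong f g (f⊑g , g⊑f) vs [] =
  indicator-cong (constant? f vs) (constant? g vs)
    (λ c x∈ y∈ → f⊑g (c x∈ y∈)) (λ c x∈ y∈ → g⊑f (c x∈ y∈))
treeCount-cong f g f≈g vs ((u , v) ∷ L) = cong₂ _+_
  (unless-cong (f u Fin.≟ f v) (g u Fin.≟ g v) (proj₁ f≈g) (proj₂ f≈g)
    (treeCount-cong _ _ (contract-cong f g u v f≈g) vs L))
  (treeCount-cong f g f≈g vs L)

treeCount-vertices : (f : Labelling V m) {vs ws : List V} →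
                     (∀ {x} → x ∈ vs → x ∈ ws) → (∀ {x} → x ∈ ws → x ∈ vs) →
                     ∀ L → treeCount f vs L ≡ treeCount f ws L
treeCount-vertices f {vs} {ws} vs⊆ws ws⊆vs [] =
  indicator-cong (constant? f vs) (constant? f ws)
    (λ c x∈ y∈ → c (ws⊆vs x∈) (ws⊆vs y∈)) (λ c x∈ y∈ → c (vs⊆ws x∈) (vs⊆ws y∈))
treeCount-vertices f vs⊆ws ws⊆vs ((u , v) ∷ L) = cong₂ _+_
  (cong (unless (f u Fin.≟ f v)) (treeCount-vertices (contract f u v) vs⊆ws ws⊆vs L))
  (treeCount-vertices f vs⊆ws ws⊆vs L)

relabel : (V → W) → Edges V → Edges W
relabel f = map (Product.map f f)

-- Passes from a glued labelling to a genuinely smaller graph. The recursions agree because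
-- `contract (f ∘ g) u v` is by definition `contract f (g u) (g v) ∘ g`.
treeCount-relabel : (f : Labelling W m) (g : V → W) → ∀ vs L →
                    treeCount (f ∘ g) vs L ≡ treeCount f (map g vs) (relabel g L)
treeCount-relabel f g vs [] =
  indicator-cong (constant? (f ∘ g) vs) (constant? f (map g vs))
    (λ c x∈ y∈ → let (_ , x′∈ , eq) = ∈-map⁻ g x∈ ; (_ , y′∈ , eq′) = ∈-map⁻ g y∈ in
      trans (cong f eq) (trans (c x′∈ y′∈) (cong f (sym eq′))))
    (λ c x∈ y∈ → c (∈-map⁺ g x∈) (∈-map⁺ g y∈))
treeCount-relabel f g vs ((u , v) ∷ L) = cong₂ _+_
  (cong (unless (f (g u) Fin.≟ f (g v))) (treeCount-relabel (contract f (g u) (g v)) g vs L))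
  (treeCount-relabel f g vs L)

treeCount-loop : (f : Labelling V m) {u v : V} → f u ≡ f v →
                 ∀ vs L → treeCount f vs ((u , v) ∷ L) ≡ treeCount f vs L
treeCount-loop f {u} {v} eq vs L =
  cong (_+ treeCount f vs L) (unless-yes (f u Fin.≟ f v) eq (treeCount (contract f u v) vs L))

treeCount-flip : (f : Labelling V m) (u v : V) → ∀ vs L →
                 treeCount f vs ((u , v) ∷ L) ≡ treeCount f vs ((v , u) ∷ L)
treeCount-flip f u v vs L = cong (_+ treeCount f vs L)
  (unless-cong (f u Fin.≟ f v) (f v Fin.≟ f u) sym sym
    (treeCount-cong _ _
      (contract-⊑ f (contract f v u) (⊑-contract f v u) (sym (contract-glues f v u)) ,
       contract-⊑ f (contract f u v) (⊑-contract f u v) (sym (contract-glues f u v))) vs L))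

-- An edge inside a class stays inside one after any contraction. Otherwise both orders expand into
-- the same four terms, with both edges, either one or neither contracted.
treeCount-swap : (f : Labelling V m) (d e : V × V) → ∀ vs L →
                 treeCount f vs (d ∷ e ∷ L) ≡ treeCount f vs (e ∷ d ∷ L)
treeCount-swap f d@(u , v) e@(p , q) vs L with f u Fin.≟ f v | f p Fin.≟ f q
... | yes u≈v | yes p≈q = refl
... | yes u≈v | no  p≉q =
  sym (cong (_+ treeCount f vs L) (treeCount-loop (contract f p q) {u} {v} (⊑-contract f p q u≈v) vs L))
... | no  u≉v | yes p≈q =
  cong (_+ treeCount f vs L) (treeCount-loop (contract f u v) {p} {q} (⊑-contract f u v p≈q) vs L)
... | no  u≉v | no  p≉q = begin
  (X + treeCount fᵤ vs L) + (treeCount fₚ vs L + treeCount f vs L)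
    ≡⟨ solve 4 (λ x a b c → (x :+ a) :+ (b :+ c) := (x :+ b) :+ (a :+ c)) refl
         X (treeCount fᵤ vs L) (treeCount fₚ vs L) (treeCount f vs L) ⟩
  (X + treeCount fₚ vs L) + (treeCount fᵤ vs L + treeCount f vs L)
    ≡⟨ cong (λ z → (z + treeCount fₚ vs L) + (treeCount fᵤ vs L + treeCount f vs L))
         (unless-cong (fᵤ p Fin.≟ fᵤ q) (fₚ u Fin.≟ fₚ v)
           -- `contract-swap-≢` transports inequalities only; decidability of equality turns its
           -- contrapositive into a map between equalities.
           (λ eq → decidable-stable (fₚ u Fin.≟ fₚ v) λ ¬eq → contract-swap-≢ f p q u v p≉q ¬eq eq)
           (λ eq → decidable-stable (fᵤ p Fin.≟ fᵤ q) λ ¬eq → contract-swap-≢ f u v p q u≉v ¬eq eq)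
           (treeCount-cong _ _ (contract-swap f u v p q) vs L)) ⟩
  (unless (fₚ u Fin.≟ fₚ v) (treeCount (contract fₚ u v) vs L) + treeCount fₚ vs L) +
    (treeCount fᵤ vs L + treeCount f vs L) ∎
  where
  open ≡-Reasoning
  open +-*-Solver
  fᵤ = contract f u v
  fₚ = contract f p q
  X = unless (fᵤ p Fin.≟ fᵤ q) (treeCount (contract fᵤ p q) vs L)

treeCount-∷ : (vs : List V) (e : V × V) (L M : Edges V) →
              (∀ (f : Labelling V m) → treeCount f vs L ≡ treeCount f vs M) →
              ∀ (f : Labelling V m) → treeCount f vs (e ∷ L) ≡ treeCount f vs (e ∷ M)
treeCount-∷ vs (u , v) L M eq f = cong₂ _+_ (cong (unless (f u Fin.≟ f v)) (eq (contract f u v))) (eq f)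

treeCount-↭ : (vs : List V) {L M : Edges V} → L ↭ M →
              (f : Labelling V m) → treeCount f vs L ≡ treeCount f vs M
treeCount-↭ vs ↭.refl f = refl
treeCount-↭ vs (↭.prep {L} {M} e L↭M) f = treeCount-∷ vs e L M (treeCount-↭ vs L↭M) f
treeCount-↭ vs (↭.swap {L} {M} d e L↭M) f = trans (treeCount-swap f d e vs L)
  (treeCount-∷ vs e (d ∷ L) (d ∷ M) (treeCount-∷ vs d L M (treeCount-↭ vs L↭M)) f)
treeCount-↭ vs (↭.trans L↭M M↭N) f = trans (treeCount-↭ vs L↭M f) (treeCount-↭ vs M↭N f)

treeCount-loopless : (f : Labelling (Fin m) k) → ∀ vs L →
                     treeCount f vs (filter (λ (u , v) → ¬? (u Fin.≟ v)) L) ≡ treeCount f vs L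
treeCount-loopless f vs [] = refl
treeCount-loopless f vs ((u , v) ∷ L) with u Fin.≟ v
... | yes refl = trans (treeCount-loopless f vs L) (sym (treeCount-loop f {u} refl vs L))
... | no  _    = cong₂ _+_ (cong (unless (f u Fin.≟ f v)) (treeCount-loopless (contract f u v) vs L))
                           (treeCount-loopless f vs L)

length-filter-map : {A B : Set} {P : Pred B 0ℓ} (P? : Decidable P) (g : A → B) (xs : List A) →
                    length (filter P? (map g xs)) ≡ length (filter (P? ∘ g) xs)
length-filter-map P? g [] = refl
length-filter-map P? g (x ∷ xs) with P? (g x)
... | yes _ = cong suc (length-filter-map P? g xs)
... | no  _ = length-filter-map P? g xs

count-suc : {P : Pred (Subset (suc n)) 0ℓ} (P? : Decidable P) →
            count P? ≡ count (P? ∘ (inside ∷_)) + count (P? ∘ (outside ∷_))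
count-suc {n} P? = begin
  length (filter P? (map (inside ∷_) (subsets n) ++ map (outside ∷_) (subsets n)))
    ≡⟨ cong length (filter-++ P? (map (inside ∷_) (subsets n)) _) ⟩
  length (filter P? (map (inside ∷_) (subsets n)) ++ filter P? (map (outside ∷_) (subsets n)))
    ≡⟨ length-++ (filter P? (map (inside ∷_) (subsets n))) ⟩
  _ ≡⟨ cong₂ _+_ (length-filter-map P? (inside ∷_) (subsets n))
                 (length-filter-map P? (outside ∷_) (subsets n)) ⟩
  count (P? ∘ (inside ∷_)) + count (P? ∘ (outside ∷_)) ∎
  where open ≡-Reasoning

count-none : {P : Pred (Subset n) 0ℓ} (P? : Decidable P) → (∀ A → ¬ P A) → count P? ≡ 0
count-none {n} P? ¬P = cong length (filter-none P? (All.tabulate {xs = subsets n} (λ {A} _ → ¬P A)))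

-- `P` is kept abstract because the induction passes to `P? ∘ (inside ∷_)`, which is no longer the
-- decision procedure of a graph.
count-trees : (f : Labelling (Fin n) m) (L : Edges (Fin n)) {P : Pred (Subset (length L)) 0ℓ}
              (P? : Decidable P) → (∀ A → P A ⇔ Tree f L A) →
              count P? ≡ treeCount f (allFin n) L
count-trees {n} f [] P? P⇔T with P? [] | constant? f (allFin n)
... | yes p | yes _ = refl
... | no  _ | no  _ = refl
... | yes p | no ¬c = contradiction (λ {x} {y} _ _ → proj₂ (to (P⇔T []) p) x y) ¬c
... | no ¬p | yes c = contradiction (from (P⇔T []) (_ , λ x y → c (∈-allFin x) (∈-allFin y))) ¬p
count-trees f ((u , v) ∷ L) {P} P? P⇔T =
  trans (count-suc P?) (cong₂ _+_ count-inside (count-trees f L _ (P⇔T ∘ (outside ∷_))))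
  where
  count-inside : count (P? ∘ (inside ∷_)) ≡ unless (f u Fin.≟ f v) (treeCount (contract f u v) (allFin _) L)
  count-inside with f u Fin.≟ f v
  ... | yes u≈v = count-none (P? ∘ (inside ∷_)) λ A p → proj₁ (proj₁ (to (P⇔T (inside ∷ A)) p)) u≈v
  ... | no  u≉v = count-trees (contract f u v) L (P? ∘ (inside ∷_)) λ A → mk⇔
    (λ p → let ((_ , F) , C) = to (P⇔T (inside ∷ A)) p in F , C)
    (λ (F , C) → from (P⇔T (inside ∷ A)) ((u≉v , F) , C))

module _ (G : Multigraph) where
  open Multigraph G

  rootedForests≡treeCount : {S : Subset order} → Nonempty S → {c : Labelling Vertex m} → Collapses S c →
                            𝓕 G S ≡ treeCount c (allFin order) edges
  rootedForests≡treeCount {S = S} S≢∅ {c} collapsing =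
    count-trees c edges (isRootedForest? G S) (isRootedForest⇔tree collapsing S≢∅ edges)

  spanningTrees≡treeCount : τ G ≡ treeCount id (allFin order) edges
  spanningTrees≡treeCount = count-trees id edges (isSpanningTree? G) (isSpanningTree⇔tree edges)

-- Moving the labelling `collapse S` into the edges gives the edges of the quotient, up to loops,
-- which add nothing to the count.
rootedForests≡τ-quotient : (G : Multigraph) {S : Subset (Multigraph.order G)} → Nonempty S →
                           𝓕 G S ≡ τ (G / S)
rootedForests≡τ-quotient G {S} S≢∅ = begin
  𝓕 G S
    ≡⟨ rootedForests≡treeCount G S≢∅ (collapse-collapses S) ⟩
  treeCount (collapse S) (allFin order) edges
    ≡⟨ treeCount-relabel id (collapse S) (allFin order) edges ⟩
  treeCount id (map (collapse S) (allFin order)) (relabel (collapse S) edges)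
    -- The image list may contain repetitions; only membership matters, and `collapse S` is onto
    -- since `S` is nonempty.
    ≡⟨ treeCount-vertices id (λ _ → ∈-allFin _)
         (λ {k} _ → let (x , eq) = collapse-surjective S≢∅ k in
           subst (_∈ _) eq (∈-map⁺ (collapse S) (∈-allFin x)))
         (relabel (collapse S) edges) ⟩
  treeCount id (allFin _) (relabel (collapse S) edges)
    ≡⟨ treeCount-loopless id (allFin _) (relabel (collapse S) edges) ⟨
  treeCount id (allFin _) (Multigraph.edges (G / S))
    ≡⟨ spanningTrees≡treeCount (G / S) ⟨
  τ (G / S) ∎
  where
  open ≡-Reasoning
  open Multigraph G

-- Contracting an edge that does not touch the class of `x` leaves that class alone, so `w` never
-- joins it.
treeCount-isolated : (f : Labelling V m) {vs : List V} {x w : V} → x ∈ vs → w ∈ vs → f x ≢ f w →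
                     (L : Edges V) → All (λ (u , v) → f x ≢ f u × f x ≢ f v) L →
                     treeCount f vs L ≡ 0
treeCount-isolated f {vs} x∈ w∈ x≢w [] [] with constant? f vs
... | yes c = contradiction (c x∈ w∈) x≢w
... | no _  = refl
treeCount-isolated f {vs} {x} {w} x∈ w∈ x≢w ((u , v) ∷ L) ((x≢u , x≢v) ∷ iso) = cong₂ _+_
  (trans (cong (unless (f u Fin.≟ f v))
           (treeCount-isolated (contract f u v) x∈ w∈ (apart x≢w) L (All.map (Product.map apart apart) iso)))
         (unless-zero (f u Fin.≟ f v)))
  (treeCount-isolated f x∈ w∈ x≢w L iso)
  where
  apart : ∀ {z} → f x ≢ f z → contract f u v x ≢ contract f u v z
  apart x≢z eq with merge-kernel (f u) (f v) eq
  ... | inj₁ x≡z                = x≢z x≡z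
  ... | inj₂ (inj₁ (x≡u , _)) = x≢u x≡u
  ... | inj₂ (inj₂ (x≡v , _)) = x≢v x≡v

  unless-zero : {P : Set} (P? : Dec P) → unless P? 0 ≡ 0
  unless-zero (yes _) = refl
  unless-zero (no _)  = refl

trees : List (Fin m) → Edges (Fin m) → ℕ
trees = treeCount id

trees-edge : {u v : Fin m} → u ≢ v → ∀ vs L →
             trees vs ((u , v) ∷ L) ≡ trees (map (merge u v) vs) (relabel (merge u v) L) + trees vs L
trees-edge {u = u} {v} u≢v vs L = cong (_+ trees vs L)
  (trans (unless-no (u Fin.≟ v) u≢v _) (treeCount-relabel id (merge u v) vs L))

trees-absorb : {x : Fin m} {vs : List (Fin m)} → x ∈ vs → ∀ L → trees (x ∷ vs) L ≡ trees vs L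
trees-absorb x∈vs = treeCount-vertices id (λ { (here refl) → x∈vs ; (there y∈) → y∈ }) there

-- Fans and wheels

-- The start `x` has no spoke here, since a spoke is listed right after the rim edge entering its
-- vertex. Glued roots appear as further occurrences of `h`, also as `x`.
fan : V → V → List V → Edges V
fan h x []       = []
fan h x (y ∷ ys) = (x , y) ∷ (h , y) ∷ fan h y ys

relabel-fan : (f : V → W) (h x : V) (ys : List V) → relabel f (fan h x ys) ≡ fan (f h) (f x) (map f ys)
relabel-fan f h x []       = refl
relabel-fan f h x (y ∷ ys) = cong (λ L → _ ∷ _ ∷ L) (relabel-fan f h y ys)

merge-map : (x : Fin m) {y : Fin m} {ys : List (Fin m)} → All (y ≢_) ys → map (merge x y) ys ≡ ys
merge-map x = map-id-local ∘ All.map (λ y≢z → merge-fixes (y≢z ∘ sym))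

merge-fan : (x : Fin m) {h y : Fin m} {ys : List (Fin m)} → y ≢ h → All (y ≢_) ys →
            relabel (merge x y) (fan h y ys) ≡ fan h x ys
merge-fan x {h} {y} {ys} y≢h y∉ys
  rewrite relabel-fan (merge x y) h y ys | merge-map x y∉ys | merge-target x y
        | merge-fixes {p = x} (y≢h ∘ sym) = refl

fib-even : ∀ k → fib (2 * suc k) ≡ fib (suc (2 * k)) + fib (2 * k)
fib-even k = cong fib (*-suc 2 k)

fib-odd : ∀ k → fib (suc (2 * suc k)) ≡ fib (2 * suc k) + fib (suc (2 * k))
fib-odd k = cong (λ j → fib (2 * suc k) + fib j) (+-suc k (k + 0))

module _ (h : Fin m) where
  -- At x = h this counts the completions in the state H, and at x ≢ h those in the state X.
  fanTrees : Fin m → List (Fin m) → ℕ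
  fanTrees x ys = trees (h ∷ x ∷ ys) (fan h x ys)

  merge-hub : {x : Fin m} {ys : List (Fin m)} → x ≢ h → All (x ≢_) ys →
              trees (map (merge h x) (h ∷ x ∷ ys)) (relabel (merge h x) (fan h x ys)) ≡ fanTrees h ys
  merge-hub {x} {ys} x≢h x∉ys
    rewrite merge-fan h x≢h x∉ys | merge-map h x∉ys | merge-target h x
          | merge-fixes {p = h} (x≢h ∘ sym) = refl

  -- Rim edge and spoke are parallel edges from `h` to `y`: taking either one makes the other a
  -- loop, whence twice the first count, and taking neither leaves `y` unattached.
  fan-hub-rim : {y : Fin m} {ys : List (Fin m)} → y ≢ h → All (y ≢_) ys →
                fanTrees h (y ∷ ys) ≡ fanTrees h ys + (fanTrees h ys + fanTrees y ys)
  fan-hub-rim {y} {ys} y≢h y∉ys = begin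
    trees (h ∷ h ∷ y ∷ ys) ((h , y) ∷ (h , y) ∷ fan h y ys)
      ≡⟨ trees-absorb (here refl) ((h , y) ∷ (h , y) ∷ fan h y ys) ⟩
    trees (h ∷ y ∷ ys) ((h , y) ∷ (h , y) ∷ fan h y ys)
      ≡⟨ trees-edge (y≢h ∘ sym) (h ∷ y ∷ ys) ((h , y) ∷ fan h y ys) ⟩
    trees (map (merge h y) (h ∷ y ∷ ys)) ((merge h y h , merge h y y) ∷ relabel (merge h y) (fan h y ys))
      + trees (h ∷ y ∷ ys) ((h , y) ∷ fan h y ys)
      ≡⟨ cong₂ _+_
           (treeCount-loop id (merge-glues h y) (map (merge h y) (h ∷ y ∷ ys))
             (relabel (merge h y) (fan h y ys)))
           (trees-edge (y≢h ∘ sym) (h ∷ y ∷ ys) (fan h y ys)) ⟩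
    T + (T + fanTrees y ys)
      ≡⟨ cong (λ t → t + (t + fanTrees y ys)) (merge-hub y≢h y∉ys) ⟩
    fanTrees h ys + (fanTrees h ys + fanTrees y ys) ∎
    where
    open ≡-Reasoning
    T = trees (map (merge h y) (h ∷ y ∷ ys)) (relabel (merge h y) (fan h y ys))

  fan-hub-hub : (ys : List (Fin m)) → fanTrees h (h ∷ ys) ≡ fanTrees h ys
  fan-hub-hub ys = begin
    trees (h ∷ h ∷ h ∷ ys) ((h , h) ∷ (h , h) ∷ fan h h ys)
      ≡⟨ treeCount-loop id {h} {h} refl (h ∷ h ∷ h ∷ ys) ((h , h) ∷ fan h h ys) ⟩
    trees (h ∷ h ∷ h ∷ ys) ((h , h) ∷ fan h h ys)
      ≡⟨ treeCount-loop id {h} {h} refl (h ∷ h ∷ h ∷ ys) (fan h h ys) ⟩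
    trees (h ∷ h ∷ h ∷ ys) (fan h h ys)
      ≡⟨ trees-absorb (here refl) (fan h h ys) ⟩
    fanTrees h ys ∎
    where open ≡-Reasoning

  fan-avoids : {x y : Fin m} {ys : List (Fin m)} → x ≢ h → All (x ≢_) (y ∷ ys) →
               All (λ (u , v) → x ≢ u × x ≢ v) (fan h y ys)
  fan-avoids {ys = []}     x≢h _                    = []
  fan-avoids {ys = _ ∷ _} x≢h (x≢y ∷ x≢z ∷ x∉ys) =
    (x≢y , x≢z) ∷ (x≢h , x≢z) ∷ fan-avoids x≢h (x≢z ∷ x∉ys)

  trees-isolated : {x : Fin m} {ys : List (Fin m)} → x ≢ h → (L : Edges (Fin m)) →
                   All (λ (u , v) → x ≢ u × x ≢ v) L → trees (h ∷ x ∷ ys) L ≡ 0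
  trees-isolated x≢h = treeCount-isolated id (there (here refl)) (here refl) x≢h

  -- Deleting the rim edge would isolate `x`, so it is contracted; then the spoke, now at `x`, is
  -- either contracted or deleted.
  fan-rim-rim : {x y : Fin m} {ys : List (Fin m)} → x ≢ h → y ≢ h → All (x ≢_) (y ∷ ys) → All (y ≢_) ys →
                fanTrees x (y ∷ ys) ≡ fanTrees h ys + fanTrees x ys
  fan-rim-rim {x} {y} {ys} x≢h y≢h (x≢y ∷ x∉ys) y∉ys = begin
    trees (h ∷ x ∷ y ∷ ys) ((x , y) ∷ (h , y) ∷ fan h y ys)
      ≡⟨ trees-edge x≢y (h ∷ x ∷ y ∷ ys) ((h , y) ∷ fan h y ys) ⟩
    trees (map (merge x y) (h ∷ x ∷ y ∷ ys)) (relabel (merge x y) ((h , y) ∷ fan h y ys))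
      + trees (h ∷ x ∷ y ∷ ys) ((h , y) ∷ fan h y ys)
      ≡⟨ cong₂ _+_ contracted
           (trees-isolated x≢h ((h , y) ∷ fan h y ys) ((x≢h , x≢y) ∷ fan-avoids x≢h (x≢y ∷ x∉ys))) ⟩
    trees (h ∷ x ∷ x ∷ ys) ((h , x) ∷ fan h x ys) + 0
      ≡⟨ +-identityʳ _ ⟩
    trees (h ∷ x ∷ x ∷ ys) ((h , x) ∷ fan h x ys)
      ≡⟨ treeCount-vertices id
           (λ { (here p) → here p ; (there (here p)) → there (here p) ; (there (there p)) → there p })
           (λ { (here p) → here p ; (there p) → there (there p) }) ((h , x) ∷ fan h x ys) ⟩
    trees (h ∷ x ∷ ys) ((h , x) ∷ fan h x ys)
      ≡⟨ trees-edge (x≢h ∘ sym) (h ∷ x ∷ ys) (fan h x ys) ⟩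
    trees (map (merge h x) (h ∷ x ∷ ys)) (relabel (merge h x) (fan h x ys)) + fanTrees x ys
      ≡⟨ cong (_+ fanTrees x ys) (merge-hub x≢h x∉ys) ⟩
    fanTrees h ys + fanTrees x ys ∎
    where
    open ≡-Reasoning
    contracted : trees (map (merge x y) (h ∷ x ∷ y ∷ ys)) (relabel (merge x y) ((h , y) ∷ fan h y ys))
                 ≡ trees (h ∷ x ∷ x ∷ ys) ((h , x) ∷ fan h x ys)
    contracted rewrite merge-fan x y≢h y∉ys | merge-map x y∉ys | merge-target x y
                     | merge-fixes {p = x} (y≢h ∘ sym) | merge-fixes {p = x} x≢y = refl

  -- The rim edge into the root is the last chance of `x` to reach the hub, so it must be taken.
  fan-rim-hub : {x : Fin m} {ys : List (Fin m)} → x ≢ h → All (x ≢_) ys →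
                fanTrees x (h ∷ ys) ≡ fanTrees h ys
  fan-rim-hub {x} {ys} x≢h x∉ys = begin
    trees (h ∷ x ∷ h ∷ ys) ((x , h) ∷ (h , h) ∷ fan h h ys)
      -- merge keeps the first end of an edge as the label, and the hub has to survive.
      ≡⟨ treeCount-flip id x h (h ∷ x ∷ h ∷ ys) ((h , h) ∷ fan h h ys) ⟩
    trees (h ∷ x ∷ h ∷ ys) ((h , x) ∷ (h , h) ∷ fan h h ys)
      ≡⟨ trees-edge (x≢h ∘ sym) (h ∷ x ∷ h ∷ ys) ((h , h) ∷ fan h h ys) ⟩
    trees (map (merge h x) (h ∷ x ∷ h ∷ ys)) (relabel (merge h x) ((h , h) ∷ fan h h ys))
      + trees (h ∷ x ∷ h ∷ ys) ((h , h) ∷ fan h h ys)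
      ≡⟨ cong₂ _+_ contracted
           (trees-isolated x≢h ((h , h) ∷ fan h h ys) ((x≢h , x≢h) ∷ fan-avoids x≢h (x≢h ∷ x∉ys))) ⟩
    trees (h ∷ h ∷ h ∷ ys) ((h , h) ∷ fan h h ys) + 0
      ≡⟨ +-identityʳ _ ⟩
    trees (h ∷ h ∷ h ∷ ys) ((h , h) ∷ fan h h ys)
      ≡⟨ treeCount-loop id {h} {h} refl (h ∷ h ∷ h ∷ ys) (fan h h ys) ⟩
    trees (h ∷ h ∷ h ∷ ys) (fan h h ys)
      ≡⟨ trees-absorb (here refl) (fan h h ys) ⟩
    fanTrees h ys ∎
    where
    open ≡-Reasoning
    contracted : trees (map (merge h x) (h ∷ x ∷ h ∷ ys)) (relabel (merge h x) ((h , h) ∷ fan h h ys))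
                 ≡ trees (h ∷ h ∷ h ∷ ys) ((h , h) ∷ fan h h ys)
    contracted rewrite relabel-fan (merge h x) h h ys | merge-map h x∉ys | merge-target h x
                     | merge-fixes {p = h} (x≢h ∘ sym) = refl

  -- Replaces `Unique`, which fails once both rim roots carry the hub's label.
  OnlyHubRepeats : List (Fin m) → Set
  OnlyHubRepeats = AllPairs (λ x y → x ≡ y → x ≡ h)

  -- The two states are treated together because each recursion uses both. The root that ends the
  -- block leaves the factor `fanTrees h zs` in either state.
  fan-block : ∀ ys zs → All (_≢ h) ys → OnlyHubRepeats (ys ++ h ∷ zs) →
    fanTrees h (ys ++ h ∷ zs) ≡ fib (2 * suc (length ys)) * fanTrees h zs ×
    (∀ {x} → x ≢ h → All (x ≢_) (ys ++ h ∷ zs) →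
      fanTrees x (ys ++ h ∷ zs) ≡ fib (suc (2 * length ys)) * fanTrees h zs)
  fan-block [] zs [] (_ ∷ _) =
    -- The factors here are F_2 and F_1; both compute to 1, and `1 * Z` to `Z + 0`.
    trans (fan-hub-hub zs) (sym (+-identityʳ _)) ,
    λ { x≢h (_ ∷ x∉zs) → trans (fan-rim-hub x≢h x∉zs) (sym (+-identityʳ _)) }
  fan-block (y ∷ ys) zs (y≢h ∷ ys≢h) (y∼ws ∷ ws∼ws) =
    (begin
      fanTrees h (y ∷ ws)
        ≡⟨ fan-hub-rim y≢h y∉ws ⟩
      fanTrees h ws + (fanTrees h ws + fanTrees y ws)
        ≡⟨ cong₂ (λ s t → s + (s + t)) from-hub (from-rim y≢h y∉ws) ⟩
      a * Z + (a * Z + b * Z)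
        ≡⟨ solve 3 (λ a b z → a :* z :+ (a :* z :+ b :* z) := ((a :+ b) :+ a) :* z) refl a b Z ⟩
      -- With a = F_{2l+2} and b = F_{2l+1}, the sum 2a + b is F_{2l+3} + F_{2l+2} = F_{2l+4}.
      ((a + b) + a) * Z
        ≡⟨ cong (λ c → (c + a) * Z) (fib-odd l) ⟨
      (fib (suc (2 * suc l)) + a) * Z
        ≡⟨ cong (_* Z) (fib-even (suc l)) ⟨
      fib (2 * suc (suc l)) * Z ∎) ,
    λ { {x} x≢h (x≢y ∷ x∉ws) → begin
      fanTrees x (y ∷ ws)
        ≡⟨ fan-rim-rim x≢h y≢h (x≢y ∷ x∉ws) y∉ws ⟩
      fanTrees h ws + fanTrees x ws
        ≡⟨ cong₂ _+_ from-hub (from-rim x≢h x∉ws) ⟩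
      a * Z + b * Z
        ≡⟨ *-distribʳ-+ Z a b ⟨
      (a + b) * Z
        ≡⟨ cong (_* Z) (fib-odd l) ⟨
      fib (suc (2 * suc l)) * Z ∎ }
    where
    open ≡-Reasoning
    open +-*-Solver
    ws = ys ++ h ∷ zs
    l = length ys
    a = fib (2 * suc l)
    b = fib (suc (2 * l))
    Z = fanTrees h zs

    from-hub = proj₁ (fan-block ys zs ys≢h ws∼ws)
    from-rim = λ {x} → proj₂ (fan-block ys zs ys≢h ws∼ws) {x}

    y∉ws : All (y ≢_) ws
    y∉ws = All.map (y≢h ∘_) y∼ws

-- The rim as a periodic sequence

window : (ℕ → V) → ℕ → ℕ → List V
window f k zero    = []
window f k (suc l) = f k ∷ window f (suc k) l

length-window : (f : ℕ → V) → ∀ k l → length (window f k l) ≡ l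
length-window f k zero    = refl
length-window f k (suc l) = cong suc (length-window f (suc k) l)

window-++ : (f : ℕ → V) → ∀ k l l′ → window f k (l + l′) ≡ window f k l ++ window f (k + l) l′
window-++ f k zero    l′ = cong (λ j → window f j l′) (sym (+-identityʳ k))
window-++ f k (suc l) l′ = cong (f k ∷_)
  (trans (window-++ f (suc k) l l′) (cong (λ j → window f (suc k) l ++ window f j l′) (sym (+-suc k l))))

window-∷ʳ : (f : ℕ → V) → ∀ k l → window f k (suc l) ≡ window f k l ∷ʳ f (k + l)
window-∷ʳ f k zero    = cong (λ j → f j ∷ []) (sym (+-identityʳ k))
window-∷ʳ f k (suc l) = cong (f k ∷_)
  (trans (window-∷ʳ f (suc k) l) (cong (λ j → window f (suc k) l ∷ʳ f j) (sym (+-suc k l))))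

-- Each step moves the first entry to the end, where periodicity gives it the index one past the old
-- last one.
window-rotate : (f : ℕ → V) (l : ℕ) → (∀ k → f (k + suc l) ≡ f k) →
                ∀ a → window f 0 (suc l) ↭ window f a (suc l)
window-rotate f l periodic zero    = ↭.refl
window-rotate f l periodic (suc a) = ↭-trans (window-rotate f l periodic a)
  (↭-trans (∷↭∷ʳ (f a) (window f (suc a) l)) (↭-reflexive
    (trans (cong (window f (suc a) l ∷ʳ_) (trans (sym (periodic a)) (cong f (+-suc a l))))
           (sym (window-∷ʳ f (suc a) l)))))

tabulate≡window : (f : ℕ → V) (g : Fin n → V) → ∀ k → (∀ i → g i ≡ f (k + toℕ i)) →
                  tabulate g ≡ window f k n
tabulate≡window {n = zero}  f g k eq = refl
tabulate≡window {n = suc n} f g k eq = cong₂ _∷_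
  (trans (eq zero) (cong f (+-identityʳ k)))
  (tabulate≡window f (g ∘ suc) (suc k) λ i → trans (eq (suc i)) (cong f (+-suc k (toℕ i))))

-- The spokes start one index later than the rim edges, so that each rim edge is paired with the
-- spoke at its far end.
fan-window : (h : V) (w : ℕ → V) → ∀ k l →
             window (λ j → w j , w (suc j)) k l ++ window (λ j → h , w j) (suc k) l
             ↭ fan h (w k) (window w (suc k) l)
fan-window h w k zero    = ↭.refl
fan-window h w k (suc l) = ↭.prep _ (↭-trans
  (shift (h , w (suc k)) (window (λ j → w j , w (suc j)) (suc k) l) (window (λ j → h , w j) (suc (suc k)) l))
  (↭.prep _ (fan-window h w (suc k) l)))

module _ (n : ℕ) where
  private
    N = suc n

  rimAt : ℕ → Fin (suc N)
  rimAt k = rim (k mod N)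

  rimAt-toℕ : (i : Fin N) → rimAt (toℕ i) ≡ rim i
  rimAt-toℕ i = cong suc (Fin.toℕ-injective
    (trans (Fin.toℕ-fromℕ< (m%n<n (toℕ i) N)) (m<n⇒m%n≡m (Fin.toℕ<n i))))

  rimAt-periodic : ∀ k → rimAt (k + N) ≡ rimAt k
  rimAt-periodic k = cong suc (Fin.toℕ-injective (begin
    toℕ ((k + N) mod N) ≡⟨ Fin.toℕ-fromℕ< (m%n<n (k + N) N) ⟩
    (k + N) % N         ≡⟨ [m+n]%n≡m%n k N ⟩
    k % N               ≡⟨ Fin.toℕ-fromℕ< (m%n<n k N) ⟨
    toℕ (k mod N)       ∎))
    where open ≡-Reasoning

  -- Starting after `a` puts `a` itself last: the fan from `a` along this list runs once round the
  -- wheel and closes at a root.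
  rimVertices : ℕ → List (Fin (suc N))
  rimVertices a = window rimAt (suc a) N

  vertices↭ : ∀ a → allFin (suc N) ↭ hub ∷ rimVertices a
  vertices↭ a = ↭.prep hub (↭-trans
    (↭-reflexive (tabulate≡window rimAt suc 0 (sym ∘ rimAt-toℕ)))
    (window-rotate rimAt n rimAt-periodic (suc a)))

  edges↭ : ∀ a → Multigraph.edges (wheel N) ↭ fan hub (rimAt a) (rimVertices a)
  edges↭ a = ↭-trans (++⁺ rims spokes) (fan-window hub rimAt a N)
    where
    rims : map (λ i → rim i , rim (next i)) (allFin N) ↭ window (λ j → rimAt j , rimAt (suc j)) a N
    rims = ↭-trans
      (↭-reflexive (trans (map-tabulate id _)
        (tabulate≡window (λ j → rimAt j , rimAt (suc j)) _ 0
          λ i → cong (_, rim (next i)) (sym (rimAt-toℕ i)))))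
      (window-rotate _ n (λ k → cong₂ _,_ (rimAt-periodic k) (rimAt-periodic (suc k))) a)

    spokes : map (λ i → hub , rim i) (allFin N) ↭ window (λ j → hub , rimAt j) (suc a) N
    spokes = ↭-trans
      (↭-reflexive (trans (map-tabulate id _)
        (tabulate≡window (λ j → hub , rimAt j) _ 0 λ i → cong (hub ,_) (sym (rimAt-toℕ i)))))
      (window-rotate _ n (λ k → cong (hub ,_) (rimAt-periodic k)) (suc a))

  rimVertices-unique : ∀ a → Unique (hub ∷ rimVertices a)
  rimVertices-unique a =
    ↭ₛ.Unique-resp-↭ (≡.setoid _) (↭⇒↭ₛ (vertices↭ a)) (Unique.allFin⁺ (suc N))

  wheel-trees : (g : Fin (suc N) → Fin (suc N)) → g hub ≡ hub → ∀ a → g (rimAt a) ≡ hub →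
                treeCount g (allFin (suc N)) (Multigraph.edges (wheel N))
                ≡ fanTrees hub hub (map g (rimVertices a))
  wheel-trees g g-hub a g-a = begin
    treeCount g (allFin (suc N)) (Multigraph.edges (wheel N))
      ≡⟨ treeCount-↭ (allFin (suc N)) (edges↭ a) g ⟩
    treeCount g (allFin (suc N)) F
      ≡⟨ treeCount-vertices g (∈-resp-↭ (vertices↭ a)) (∈-resp-↭ (↭-sym (vertices↭ a))) F ⟩
    treeCount g (hub ∷ ws) F
      ≡⟨ treeCount-relabel id g (hub ∷ ws) F ⟩
    trees (g hub ∷ map g ws) (relabel g F)
      ≡⟨ cong₂ (λ h L → trees (h ∷ map g ws) L) g-hub (trans (relabel-fan g hub (rimAt a) ws)
           (cong₂ (λ h x → fan h x (map g ws)) g-hub g-a)) ⟩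
    trees (hub ∷ map g ws) (fan hub hub (map g ws))
      ≡⟨ trees-absorb (here refl) (fan hub hub (map g ws)) ⟨
    fanTrees hub hub (map g ws) ∎
    where
    open ≡-Reasoning
    ws = rimVertices a
    F = fan hub (rimAt a) ws

-- The two arcs between the rim roots

retract : Subset (suc n) → Fin (suc n) → Fin (suc n)
retract S v with v ∈? S
... | yes _ = zero
... | no  _ = v

retract-∈ : {S : Subset (suc n)} {v : Fin (suc n)} → v ∈ˢ S → retract S v ≡ zero
retract-∈ {S = S} {v} v∈S with v ∈? S
... | yes _   = refl
... | no v∉S = contradiction v∈S v∉S

retract-∉ : {S : Subset (suc n)} {v : Fin (suc n)} → ¬ v ∈ˢ S → retract S v ≡ v
retract-∉ {S = S} {v} v∉S with v ∈? S
... | yes v∈S = contradiction v∈S v∉S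
... | no  _   = refl

retract-collapses : {S : Subset (suc n)} → zero ∈ˢ S → Collapses S (retract S)
retract-collapses {S = S} 0∈S = record
  { collapses = λ x∈S y∈S → trans (retract-∈ x∈S) (sym (retract-∈ y∈S))
  ; separates = separates }
  where
  separates : ∀ {x y} → retract S x ≡ retract S y → x ≡ y ⊎ (x ∈ˢ S × y ∈ˢ S)
  separates {x} {y} eq with x ∈? S | y ∈? S
  ... | yes x∈S | yes y∈S = inj₂ (x∈S , y∈S)
  ... | yes x∈S | no  _   = inj₂ (x∈S , subst (_∈ˢ S) eq 0∈S)
  ... | no  _   | yes y∈S = inj₂ (subst (_∈ˢ S) (sym eq) 0∈S , y∈S)
  ... | no  _   | no  _   = inj₁ eq

unique-++ : ∀ {xs ys : List V} → Unique (xs ++ ys) → ∀ {x y} → x ∈ xs → y ∈ ys → x ≢ y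
unique-++ {xs = x ∷ xs} (x∉ ∷ _)    (here refl)  y∈ys = All.lookup (All.++⁻ʳ xs x∉) y∈ys
unique-++ {xs = x ∷ xs} (_  ∷ uniq) (there x∈xs) y∈ys = unique-++ uniq x∈xs y∈ys

allPairs-++ʳ : {R : Rel V 0ℓ} (xs {ys} : List V) → AllPairs R (xs ++ ys) → AllPairs R ys
allPairs-++ʳ []       pairs       = pairs
allPairs-++ʳ (_ ∷ xs) (_ ∷ pairs) = allPairs-++ʳ xs pairs

module _ {N : ℕ} (a b : Fin N) where
  roots : Subset (suc N)
  roots = ⁅ hub ⁆ ∪ ⁅ rim a ⁆ ∪ ⁅ rim b ⁆

  hub∈roots : hub ∈ˢ roots
  hub∈roots = x∈p∪q⁺ {p = ⁅ hub ⁆} {⁅ rim a ⁆ ∪ ⁅ rim b ⁆} (inj₁ (x∈⁅x⁆ hub))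

  a∈roots : rim a ∈ˢ roots
  a∈roots = x∈p∪q⁺ {p = ⁅ hub ⁆} {⁅ rim a ⁆ ∪ ⁅ rim b ⁆} (inj₂ (x∈p∪q⁺ (inj₁ (x∈⁅x⁆ (rim a)))))

  b∈roots : rim b ∈ˢ roots
  b∈roots = x∈p∪q⁺ {p = ⁅ hub ⁆} {⁅ rim a ⁆ ∪ ⁅ rim b ⁆}
    (inj₂ (x∈p∪q⁺ {p = ⁅ rim a ⁆} (inj₂ (x∈⁅x⁆ (rim b)))))

  ∉roots : ∀ {v} → v ≢ hub → v ≢ rim a → v ≢ rim b → ¬ v ∈ˢ roots
  ∉roots v≢hub v≢a v≢b v∈S with x∈p∪q⁻ ⁅ hub ⁆ (⁅ rim a ⁆ ∪ ⁅ rim b ⁆) v∈S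
  ... | inj₁ v∈ = v≢hub (x∈⁅y⁆⇒x≡y hub v∈)
  ... | inj₂ v∈ with x∈p∪q⁻ ⁅ rim a ⁆ ⁅ rim b ⁆ v∈
  ... | inj₁ v∈′ = v≢a (x∈⁅y⁆⇒x≡y (rim a) v∈′)
  ... | inj₂ v∈′ = v≢b (x∈⁅y⁆⇒x≡y (rim b) v∈′)

module _ {n d e : ℕ} (a b : Fin (suc n)) (b≡ : toℕ b ≡ toℕ a + suc d) (N≡ : suc n ≡ suc d + suc e) where
  private
    w = rimAt n
    g = retract (roots a b)

  -- The arcs have lengths `suc d` and `suc e`; `d` and `e` count their inner vertices.
  between-ab between-ba : List (Fin (suc (suc n)))
  between-ab = window w (suc (toℕ a)) d
  between-ba = window w (suc (toℕ b)) e

  rimVertices-split : rimVertices n (toℕ a) ≡ between-ab ++ rim b ∷ between-ba ++ rim a ∷ []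
  rimVertices-split = begin
    window w (suc i) (suc n)
      ≡⟨ cong (window w (suc i)) N≡ ⟩
    window w (suc i) (suc d + suc e)
      ≡⟨ window-++ w (suc i) (suc d) (suc e) ⟩
    window w (suc i) (suc d) ++ window w (suc i + suc d) (suc e)
      ≡⟨ cong₂ _++_ (window-∷ʳ w (suc i) d) (cong (λ j → window w (suc j) (suc e)) (sym b≡)) ⟩
    (between-ab ∷ʳ w (suc i + d)) ++ window w (suc j) (suc e)
      ≡⟨ cong₂ (λ v vs → (between-ab ∷ʳ v) ++ vs)
           (trans (cong w (trans (sym (+-suc i d)) (sym b≡))) (rimAt-toℕ n b))
           (trans (window-∷ʳ w (suc j) e)
             (cong (between-ba ∷ʳ_) (trans (cong w last) (trans (rimAt-periodic n i) (rimAt-toℕ n a))))) ⟩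
    (between-ab ∷ʳ rim b) ++ between-ba ∷ʳ rim a
      ≡⟨ ++-assoc between-ab _ _ ⟩
    between-ab ++ rim b ∷ between-ba ++ rim a ∷ [] ∎
    where
    open ≡-Reasoning
    i = toℕ a
    j = toℕ b
    -- The last index is one full turn beyond `a`, so the list ends in the root `a`.
    last : suc j + e ≡ i + suc n
    last = begin
      suc j + e               ≡⟨ +-suc j e ⟨
      j + suc e               ≡⟨ cong (_+ suc e) b≡ ⟩
      i + suc d + suc e       ≡⟨ +-assoc i (suc d) (suc e) ⟩
      i + (suc d + suc e)     ≡⟨ cong (i +_) N≡ ⟨
      i + suc n               ∎

  private
    unique : Unique (hub ∷ between-ab ++ rim b ∷ between-ba ++ rim a ∷ [])
    unique = subst (Unique ∘ (hub ∷_)) rimVertices-split (rimVertices-unique n (toℕ a))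

    rims-between : ∀ {v} → v ∈ between-ab ⊎ v ∈ between-ba → g v ≢ hub
    rims-between {v} v∈ eq = v≢hub v∈ (trans (sym (retract-∉ (∉roots a b (v≢hub v∈) (v≢a v∈) (v≢b v∈)))) eq)
      where
      rims-unique = AllPairs.tail unique
      ba-unique = allPairs-++ʳ between-ab rims-unique

      v≢hub : v ∈ between-ab ⊎ v ∈ between-ba → v ≢ hub
      v≢hub (inj₁ v∈) = All.lookup (AllPairs.head unique) (∈-++⁺ˡ v∈) ∘ sym
      v≢hub (inj₂ v∈) = All.lookup (AllPairs.head unique) (∈-++⁺ʳ between-ab (there (∈-++⁺ˡ v∈))) ∘ sym

      v≢a : v ∈ between-ab ⊎ v ∈ between-ba → v ≢ rim a
      v≢a (inj₁ v∈) = unique-++ rims-unique v∈ (there (∈-++⁺ʳ between-ba (here refl)))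
      v≢a (inj₂ v∈) = unique-++ (AllPairs.tail ba-unique) v∈ (here refl)

      v≢b : v ∈ between-ab ⊎ v ∈ between-ba → v ≢ rim b
      v≢b (inj₁ v∈) = unique-++ rims-unique v∈ (here refl)
      v≢b (inj₂ v∈) = All.lookup (AllPairs.head ba-unique) (∈-++⁺ˡ v∈) ∘ sym

    ys = map g between-ab
    zs = map g between-ba

    labels : map g (rimVertices n (toℕ a)) ≡ ys ++ hub ∷ zs ++ hub ∷ []
    labels = begin
      map g (rimVertices n (toℕ a))
        ≡⟨ cong (map g) rimVertices-split ⟩
      map g (between-ab ++ rim b ∷ between-ba ++ rim a ∷ [])
        ≡⟨ map-++ g between-ab _ ⟩
      ys ++ g (rim b) ∷ map g (between-ba ++ rim a ∷ [])
        ≡⟨ cong (λ vs → ys ++ g (rim b) ∷ vs) (map-++ g between-ba _) ⟩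
      ys ++ g (rim b) ∷ zs ++ g (rim a) ∷ []
        ≡⟨ cong₂ (λ v v′ → ys ++ v ∷ zs ++ v′ ∷ []) (retract-∈ (b∈roots a b)) (retract-∈ (a∈roots a b)) ⟩
      ys ++ hub ∷ zs ++ hub ∷ [] ∎
      where open ≡-Reasoning

    onlyHubRepeats : OnlyHubRepeats hub (ys ++ hub ∷ zs ++ hub ∷ [])
    onlyHubRepeats = subst (OnlyHubRepeats hub) labels
      (AllPairs.map⁺ (AllPairs.map only (AllPairs.tail (rimVertices-unique n (toℕ a)))))
      where
      only : ∀ {u v} → u ≢ v → g u ≡ g v → g u ≡ hub
      only u≢v eq with Collapses.separates (retract-collapses (hub∈roots a b)) eq
      ... | inj₁ u≡v       = contradiction u≡v u≢v
      ... | inj₂ (u∈S , _) = retract-∈ u∈S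

  rootedForests-wheel : 𝓕 (wheel (suc n)) (roots a b) ≡ fib (2 * suc d) * fib (2 * suc e)
  rootedForests-wheel = begin
    𝓕 (wheel (suc n)) (roots a b)
      ≡⟨ rootedForests≡treeCount (wheel (suc n)) (hub , hub∈roots a b) (retract-collapses (hub∈roots a b)) ⟩
    treeCount g (allFin (suc (suc n))) (Multigraph.edges (wheel (suc n)))
      ≡⟨ wheel-trees n g (retract-∈ (hub∈roots a b)) (toℕ a)
           (trans (cong g (rimAt-toℕ n a)) (retract-∈ (a∈roots a b))) ⟩
    fanTrees hub hub (map g (rimVertices n (toℕ a)))
      ≡⟨ cong (fanTrees hub hub) labels ⟩
    fanTrees hub hub (ys ++ hub ∷ zs ++ hub ∷ [])
      ≡⟨ proj₁ (fan-block hub ys (zs ++ hub ∷ [])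
           (All.map⁺ (All.tabulate (rims-between ∘ inj₁))) onlyHubRepeats) ⟩
    fib (2 * suc (length ys)) * fanTrees hub hub (zs ++ hub ∷ [])
      ≡⟨ cong (fib (2 * suc (length ys)) *_)
           (proj₁ (fan-block hub zs [] (All.map⁺ (All.tabulate (rims-between ∘ inj₂)))
             (AllPairs.tail (allPairs-++ʳ ys onlyHubRepeats)))) ⟩
    -- The final 1 is `fanTrees hub hub []`, the empty tree on the hub alone.
    fib (2 * suc (length ys)) * (fib (2 * suc (length zs)) * 1)
      ≡⟨ cong₂ (λ i j → fib (2 * suc i) * j)
           (trans (length-map g between-ab) (length-window w (suc (toℕ a)) d))
           (trans (*-identityʳ _) (cong (λ j → fib (2 * suc j))
             (trans (length-map g between-ba) (length-window w (suc (toℕ b)) e)))) ⟩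
    fib (2 * suc d) * fib (2 * suc e) ∎
    where open ≡-Reasoning

corollary3p5 : (N : ℕ) → 3 ≤ N → (a b : Fin N) → a Fin.< b →
  let d = toℕ b ∸ toℕ a
      S = ⁅ hub ⁆ ∪ ⁅ rim a ⁆ ∪ ⁅ rim b ⁆
  in (𝓕 (wheel N) S ≡ τ (wheel N / S)) ×
     (τ (wheel N / S) ≡ fib (2 * d) * fib (2 * (N ∸ d)))
corollary3p5 (suc n) _ a b a<b = 𝓕≡τ , trans (sym 𝓕≡τ) value
  where
  𝓕≡τ : 𝓕 (wheel (suc n)) (roots a b) ≡ τ (wheel (suc n) / roots a b)
  𝓕≡τ = rootedForests≡τ-quotient (wheel (suc n)) (hub , hub∈roots a b)

  b∸a = toℕ b ∸ toℕ a
  b∸a<N = ≤-<-trans (m∸n≤m (toℕ b) (toℕ a)) (Fin.toℕ<n b)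
  -- Strict inequality yields the difference less one, hence the numbers of inner vertices on the
  -- two arcs.
  d = proj₁ (m≤n⇒∃[o]m+o≡n a<b)
  e = proj₁ (m≤n⇒∃[o]m+o≡n b∸a<N)

  b≡ : toℕ b ≡ toℕ a + suc d
  b≡ = trans (sym (proj₂ (m≤n⇒∃[o]m+o≡n a<b))) (sym (+-suc (toℕ a) d))

  d≡ : b∸a ≡ suc d
  d≡ = trans (cong (_∸ toℕ a) b≡) (m+n∸m≡n (toℕ a) (suc d))

  N≡ : suc n ≡ suc d + suc e
  N≡ = trans (sym (proj₂ (m≤n⇒∃[o]m+o≡n b∸a<N))) (trans (sym (+-suc b∸a e)) (cong (_+ suc e) d≡))

  e≡ : suc n ∸ b∸a ≡ suc e
  e≡ = trans (cong₂ _∸_ N≡ d≡) (m+n∸m≡n (suc d) (suc e))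

  value : 𝓕 (wheel (suc n)) (roots a b) ≡ fib (2 * b∸a) * fib (2 * (suc n ∸ b∸a))
  value = trans (rootedForests-wheel a b b≡ N≡)
    (cong₂ (λ i j → fib (2 * i) * fib (2 * j)) (sym d≡) (sym e≡))
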